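{- Let $n,s,k,l$ be integers with $k\ge 1$, $k\le l\le s-1$ and $s\le n$. Then $$p^{l+1}_{n;\le s;k}-p^{l}_{n;\le s;k}=\sum_{i=k-1}^{l-2}\binom{n-1}{i-k+1}\,p_{i-k+1,\,i;\le i}\Big[p^{\,l-i}_{n+k-i-1;\le s-i-1}-p^{\,l-i-1}_{n+k-i-1;\le s-i-1}\Big]+\binom{n-1}{l-k}\,p_{l-k,\,l-1;\le l-1}\Big[p^1_{n+k-l;\le s-l}-p^{\,s-l}_{n+k-l;\le s-l;1}\Big].$$
   Context: Parking model: there are $m$ parking spaces in a line, numbered $1,\dots,m$. A preference set of length $N$ is a sequence $(a_1,\dots,a_N)$ of integers with $1\le a_i\le m$; cars $1,\dots,N$ arrive in order, car $i$ parks in the first unoccupied space numbered $\ge a_i$ if one exists, otherwise it fails to park. A $k$-flaw preference set is one where exactly $k$ cars fail to park; a $0$-flaw one is a parking function. $p_{N,m;\le t;k}$ denotes the number of $k$-flaw preference sets of length $N$ with $m$ spaces and all entries $\le t$, and $p^r_{N,m;\le t;k}$ those with first entry $r$. Conventions: omitted $k$ means $k=0$; omitted $m$ means $m=N$. Thus $p^r_{N;\le t;k}$ counts $k$-flaw preference sets with $N$ cars, $N$ spaces, entries $\le t$ and first entry $r$; $p^r_{N;\le t}$ counts such parking functions; $p_{j,m;\le t}$ counts parking functions of length $j$ with $m$ spaces and entries $\le t$ (the empty sequence counts, so $p_{0,m;\le t}=1$). -}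

module Defs where

open import Data.Nat using (ℕ; zero; suc; _+_; _∸_; _⊓_; _≡ᵇ_)
open import Data.Bool using (Bool; true; false; if_then_else_)
open import Data.List using (List; []; _∷_; map; concatMap; upTo; replicate; foldr; [_])
open import Data.Nat.ListAction using (sum)
open import Data.Integer using (ℤ) renaming (_+_ to _+ℤ_)
import Data.Integer as ℤ
open import Data.Maybe using (Maybe; just; nothing)
import Data.Maybe as Maybe

-- Occupancy of spaces 1..m as a list of Booleans (true = occupied).
-- place a occ : car with preference a parks in the first unoccupied space
-- numbered ≥ a, or fails (nothing). Positions are 1-indexed; a ≤ 1 means
-- "search from the current head".
place : ℕ → List Bool → Maybe (List Bool)
place _ [] = nothing
place (suc (suc a)) (b ∷ bs) = Maybe.map (b ∷_) (place (suc a) bs)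
place _ (true ∷ bs) = Maybe.map (true ∷_) (place 1 bs)
place _ (false ∷ bs) = just (true ∷ bs)

flawsFrom : List Bool → List ℕ → ℕ
flawsFrom occ [] = 0
flawsFrom occ (a ∷ as) with place a occ
... | nothing   = suc (flawsFrom occ as)
... | just occ' = flawsFrom occ' as

flaws : ℕ → List ℕ → ℕ
flaws m as = flawsFrom (replicate m false) as

seqs : ℕ → ℕ → List (List ℕ)
seqs zero r = [ [] ]
seqs (suc N) r = concatMap (λ a → map (a ∷_) (seqs N r)) (map suc (upTo r))

-- p_{N,m;≤t;k} : k-flaw preference sets of length N, m spaces, entries ≤ t
p : ℕ → ℕ → ℕ → ℕ → ℕ
p N m t k = sum (map (λ as → if flaws m as ≡ᵇ k then 1 else 0) (seqs N (m ⊓ t)))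

headIs : ℕ → List ℕ → Bool
headIs r [] = false
headIs r (a ∷ _) = a ≡ᵇ r

-- p^r_{N,m;≤t;k} : those with first entry r
pr : ℕ → ℕ → ℕ → ℕ → ℕ → ℕ
pr r N m t k =
  sum (map (λ as → if headIs r as then (if flaws m as ≡ᵇ k then 1 else 0) else 0)
           (seqs N (m ⊓ t)))

sumℤ : List ℤ → ℤ
sumℤ = foldr _+ℤ_ (ℤ.+ 0)

module Submission where

-- Move the first car to the end of the queue, which changes nothing since cars commute. A first
-- preference l + 1 instead of l then changes the outcome exactly when space l is the last vacant
-- space left by the other n - 1 cars, so the left side counts these configurations with k - 1
-- misses minus those with k misses.
-- With k misses, k + 1 spaces stay vacant. Cutting at the k-th of them, space i + 1, separates a
-- parking function of i + 1 - k cars on spaces 1, …, i, placed among the n - 1 cars in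
-- C(n - 1, i + 1 - k) ways, from the cars above, whose count is again a first-entry difference,
-- now for parking functions; this gives minus the sum. With k - 1 misses space l is itself the
-- k-th vacant space and every space above it ends up full; the bracket of the last term counts
-- the cars above l exactly when they do this.

module Parking where

  open import Defs
  open import Data.Nat
  open import Data.Nat.Properties
  open import Data.Nat.Combinatorics using (_C_; nCk+nC[k+1]≡[n+1]C[k+1]; k>n⇒nCk≡0)
  open import Data.Nat.ListAction using (sum)
  open import Data.Nat.ListAction.Properties using (sum-++)
  open import Data.Bool using (Bool; true; false; not; _∧_; if_then_else_)
  open import Data.Bool.Properties using (∧-zeroʳ; ∧-identityʳ)
  open import Data.Bool.ListAction using (and)
  open import Data.List using (List; []; _∷_; _++_; [_]; length; replicate; drop; take; map; concatMap; upTo; applyUpTo)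
  open import Data.List.Properties using (++-assoc; ++-identityʳ; length-++; length-replicate; map-++; map-∘)
  open import Data.List.Relation.Unary.All using (All; []; _∷_)
  import Data.List.Relation.Unary.All as All
  open import Data.Maybe using (just; nothing)
  open import Data.Product using (_×_; _,_; proj₁; proj₂; ∃₂)
  open import Data.Sum using (_⊎_; inj₁; inj₂)
  open import Data.Empty using (⊥-elim)
  open import Function using (_∘_)
  open import Relation.Binary.PropositionalEquality hiding ([_])

  indicator : Bool → ℕ
  indicator b = if b then 1 else 0

  ≡ᵇ-refl : ∀ n → (n ≡ᵇ n) ≡ true
  ≡ᵇ-refl zero = refl
  ≡ᵇ-refl (suc n) = ≡ᵇ-refl n

  ≡⇒≡ᵇ≡true : ∀ {m n} → m ≡ n → (m ≡ᵇ n) ≡ true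
  ≡⇒≡ᵇ≡true {m} refl = ≡ᵇ-refl m

  ≢⇒≡ᵇ≡false : ∀ m n → m ≢ n → (m ≡ᵇ n) ≡ false
  ≢⇒≡ᵇ≡false zero zero m≢n = ⊥-elim (m≢n refl)
  ≢⇒≡ᵇ≡false zero (suc n) _ = refl
  ≢⇒≡ᵇ≡false (suc m) zero _ = refl
  ≢⇒≡ᵇ≡false (suc m) (suc n) m≢n = ≢⇒≡ᵇ≡false m n (λ e → m≢n (cong suc e))

  ≡ᵇ≡true⇒≡ : ∀ m n → (m ≡ᵇ n) ≡ true → m ≡ n
  ≡ᵇ≡true⇒≡ zero zero _ = refl
  ≡ᵇ≡true⇒≡ (suc m) (suc n) e = cong suc (≡ᵇ≡true⇒≡ m n e)

  ∧≡true : ∀ {a b : Bool} → a ∧ b ≡ true → a ≡ true × b ≡ true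
  ∧≡true {true} {true} _ = refl , refl

  ⇔⇒≡ : ∀ (x y : Bool) → (x ≡ true → y ≡ true) → (y ≡ true → x ≡ true) → x ≡ y
  ⇔⇒≡ true true _ _ = refl
  ⇔⇒≡ true false x⇒y _ = sym (x⇒y refl)
  ⇔⇒≡ false true _ y⇒x = y⇒x refl
  ⇔⇒≡ false false _ _ = refl

  empty : ℕ → List Bool
  empty m = replicate m false

  -- Parking one car at a time

  -- The two outcomes of place a o as total functions: the new occupancy (unchanged on failure)
  -- and the number of failures, 0 or 1.
  park : ℕ → List Bool → List Bool
  park _ [] = []
  park (suc (suc a)) (b ∷ bs) = b ∷ park (suc a) bs
  park _ (true ∷ bs) = true ∷ park 1 bs
  park _ (false ∷ bs) = true ∷ bs

  miss : ℕ → List Bool → ℕ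
  miss _ [] = 1
  miss (suc (suc a)) (b ∷ bs) = miss (suc a) bs
  miss _ (true ∷ bs) = miss 1 bs
  miss _ (false ∷ bs) = 0

  misses : List Bool → List ℕ → ℕ
  misses o [] = 0
  misses o (a ∷ as) = miss a o + misses (park a o) as

  occupancy : List Bool → List ℕ → List Bool
  occupancy o [] = o
  occupancy o (a ∷ as) = occupancy (park a o) as

  place-park-miss : ∀ a o → (place a o ≡ nothing × miss a o ≡ 1 × park a o ≡ o)
                            ⊎ (place a o ≡ just (park a o) × miss a o ≡ 0)
  place-park-miss a [] = inj₁ (refl , refl , refl)
  place-park-miss (suc (suc a)) (b ∷ bs) with place (suc a) bs | place-park-miss (suc a) bs
  ... | .nothing | inj₁ (refl , m , p) = inj₁ (refl , m , cong (b ∷_) p)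
  ... | ._ | inj₂ (refl , m) = inj₂ (refl , m)
  place-park-miss zero (true ∷ bs) with place 1 bs | place-park-miss 1 bs
  ... | .nothing | inj₁ (refl , m , p) = inj₁ (refl , m , cong (true ∷_) p)
  ... | ._ | inj₂ (refl , m) = inj₂ (refl , m)
  place-park-miss (suc zero) (true ∷ bs) with place 1 bs | place-park-miss 1 bs
  ... | .nothing | inj₁ (refl , m , p) = inj₁ (refl , m , cong (true ∷_) p)
  ... | ._ | inj₂ (refl , m) = inj₂ (refl , m)
  place-park-miss zero (false ∷ bs) = inj₂ (refl , refl)
  place-park-miss (suc zero) (false ∷ bs) = inj₂ (refl , refl)

  flawsFrom≡misses : ∀ o as → flawsFrom o as ≡ misses o as
  flawsFrom≡misses o [] = refl
  flawsFrom≡misses o (a ∷ as) with place a o | place-park-miss a o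
  ... | .nothing | inj₁ (refl , m , p) rewrite m | p = cong suc (flawsFrom≡misses o as)
  ... | ._ | inj₂ (refl , m) rewrite m = flawsFrom≡misses (park a o) as

  park-0 : ∀ o → park 0 o ≡ park 1 o
  park-0 [] = refl
  park-0 (true ∷ o) = refl
  park-0 (false ∷ o) = refl

  miss-0 : ∀ o → miss 0 o ≡ miss 1 o
  miss-0 [] = refl
  miss-0 (true ∷ o) = refl
  miss-0 (false ∷ o) = refl

  miss≡0⊎miss≡1 : ∀ a o → miss a o ≡ 0 ⊎ miss a o ≡ 1
  miss≡0⊎miss≡1 a [] = inj₂ refl
  miss≡0⊎miss≡1 (suc (suc a)) (b ∷ o) = miss≡0⊎miss≡1 (suc a) o
  miss≡0⊎miss≡1 zero (true ∷ o) = miss≡0⊎miss≡1 1 o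
  miss≡0⊎miss≡1 (suc zero) (true ∷ o) = miss≡0⊎miss≡1 1 o
  miss≡0⊎miss≡1 zero (false ∷ o) = inj₁ refl
  miss≡0⊎miss≡1 (suc zero) (false ∷ o) = inj₁ refl

  miss≡1⇒park≡id : ∀ a o → miss a o ≡ 1 → park a o ≡ o
  miss≡1⇒park≡id a [] _ = refl
  miss≡1⇒park≡id (suc (suc a)) (b ∷ o) m = cong (b ∷_) (miss≡1⇒park≡id (suc a) o m)
  miss≡1⇒park≡id zero (true ∷ o) m = cong (true ∷_) (miss≡1⇒park≡id 1 o m)
  miss≡1⇒park≡id (suc zero) (true ∷ o) m = cong (true ∷_) (miss≡1⇒park≡id 1 o m)

  length-park : ∀ a o → length (park a o) ≡ length o
  length-park a [] = refl
  length-park (suc (suc a)) (b ∷ o) = cong suc (length-park (suc a) o)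
  length-park zero (true ∷ o) = cong suc (length-park 1 o)
  length-park (suc zero) (true ∷ o) = cong suc (length-park 1 o)
  length-park zero (false ∷ o) = refl
  length-park (suc zero) (false ∷ o) = refl

  length-occupancy : ∀ o as → length (occupancy o as) ≡ length o
  length-occupancy o [] = refl
  length-occupancy o (a ∷ as) = trans (length-occupancy (park a o) as) (length-park a o)

  park-comm-suc : ∀ a c o → park (suc c) (park (suc a) o) ≡ park (suc a) (park (suc c) o)
  park-comm-suc a c [] = refl
  park-comm-suc zero zero (b ∷ o) = refl
  park-comm-suc zero (suc c) (true ∷ o) = cong (true ∷_) (park-comm-suc zero c o)
  park-comm-suc zero (suc c) (false ∷ o) = refl
  park-comm-suc (suc a) zero (true ∷ o) = cong (true ∷_) (park-comm-suc a zero o)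
  park-comm-suc (suc a) zero (false ∷ o) = refl
  park-comm-suc (suc a) (suc c) (b ∷ o) = cong (b ∷_) (park-comm-suc a c o)

  miss-comm-suc : ∀ a c o → miss (suc a) o + miss (suc c) (park (suc a) o)
                           ≡ miss (suc c) o + miss (suc a) (park (suc c) o)
  miss-comm-suc a c [] = refl
  miss-comm-suc zero zero (b ∷ o) = refl
  miss-comm-suc zero (suc c) (true ∷ o) = miss-comm-suc zero c o
  miss-comm-suc zero (suc c) (false ∷ o) = +-comm 0 (miss (suc c) o)
  miss-comm-suc (suc a) zero (true ∷ o) = miss-comm-suc a zero o
  miss-comm-suc (suc a) zero (false ∷ o) = +-comm (miss (suc a) o) 0
  miss-comm-suc (suc a) (suc c) (b ∷ o) = miss-comm-suc a c o

  park-comm : ∀ a c o → park c (park a o) ≡ park a (park c o)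
  park-comm zero zero o = refl
  park-comm zero (suc c) o =
    trans (cong (park (suc c)) (park-0 o)) (trans (park-comm-suc 0 c o) (sym (park-0 (park (suc c) o))))
  park-comm (suc a) zero o =
    trans (park-0 (park (suc a) o)) (trans (park-comm-suc a 0 o) (cong (park (suc a)) (sym (park-0 o))))
  park-comm (suc a) (suc c) o = park-comm-suc a c o

  miss-comm : ∀ a c o → miss a o + miss c (park a o) ≡ miss c o + miss a (park c o)
  miss-comm zero zero o = refl
  miss-comm zero (suc c) o = begin
    miss 0 o + miss (suc c) (park 0 o)  ≡⟨ cong₂ _+_ (miss-0 o) (cong (miss (suc c)) (park-0 o)) ⟩
    miss 1 o + miss (suc c) (park 1 o)  ≡⟨ miss-comm-suc 0 c o ⟩
    miss (suc c) o + miss 1 (park (suc c) o) ≡⟨ cong (miss (suc c) o +_) (sym (miss-0 (park (suc c) o))) ⟩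
    miss (suc c) o + miss 0 (park (suc c) o) ∎
    where open ≡-Reasoning
  miss-comm (suc a) zero o = begin
    miss (suc a) o + miss 0 (park (suc a) o) ≡⟨ cong (miss (suc a) o +_) (miss-0 (park (suc a) o)) ⟩
    miss (suc a) o + miss 1 (park (suc a) o) ≡⟨ miss-comm-suc a 0 o ⟩
    miss 1 o + miss (suc a) (park 1 o)       ≡⟨ sym (cong₂ _+_ (miss-0 o) (cong (miss (suc a)) (park-0 o))) ⟩
    miss 0 o + miss (suc a) (park 0 o)       ∎
    where open ≡-Reasoning
  miss-comm (suc a) (suc c) o = miss-comm-suc a c o

  -- Since two consecutive cars commute, the first car may be moved to the end of the queue.
  misses-rotate : ∀ r o b → misses o (r ∷ b) ≡ misses o b + miss r (occupancy o b)
  misses-rotate r o [] = +-comm (miss r o) 0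
  misses-rotate r o (a ∷ b) = begin
    miss r o + (miss a (park r o) + misses (park a (park r o)) b)
      ≡⟨ sym (+-assoc (miss r o) _ _) ⟩
    miss r o + miss a (park r o) + misses (park a (park r o)) b
      ≡⟨ cong₂ _+_ (miss-comm r a o) (cong (λ x → misses x b) (park-comm r a o)) ⟩
    miss a o + miss r (park a o) + misses (park r (park a o)) b
      ≡⟨ +-assoc (miss a o) _ _ ⟩
    miss a o + misses (park a o) (r ∷ b)
      ≡⟨ cong (miss a o +_) (misses-rotate r (park a o) b) ⟩
    miss a o + (misses (park a o) b + miss r (occupancy (park a o) b))
      ≡⟨ sym (+-assoc (miss a o) _ _) ⟩
    miss a o + misses (park a o) b + miss r (occupancy (park a o) b) ∎
    where open ≡-Reasoning

  park-++-inside : ∀ a lo rest → miss a lo ≡ 0 →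
    park a (lo ++ rest) ≡ park a lo ++ rest × miss a (lo ++ rest) ≡ 0
  park-++-inside (suc (suc a)) (x ∷ lo) rest m with park-++-inside (suc a) lo rest m
  ... | p , m′ = cong (x ∷_) p , m′
  park-++-inside zero (true ∷ lo) rest m with park-++-inside 1 lo rest m
  ... | p , m′ = cong (true ∷_) p , m′
  park-++-inside (suc zero) (true ∷ lo) rest m with park-++-inside 1 lo rest m
  ... | p , m′ = cong (true ∷_) p , m′
  park-++-inside zero (false ∷ lo) rest m = refl , refl
  park-++-inside (suc zero) (false ∷ lo) rest m = refl , refl

  park-++-overflow : ∀ a lo rest → a ≤ suc (length lo) → miss a lo ≡ 1 →
    park a (lo ++ rest) ≡ lo ++ park 1 rest × miss a (lo ++ rest) ≡ miss 1 rest
  park-++-overflow zero [] rest _ _ = park-0 rest , miss-0 rest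
  park-++-overflow (suc zero) [] rest _ _ = refl , refl
  park-++-overflow (suc (suc a)) (x ∷ lo) rest (s≤s a≤) m with park-++-overflow (suc a) lo rest a≤ m
  ... | p , m′ = cong (x ∷_) p , m′
  park-++-overflow zero (true ∷ lo) rest _ m with park-++-overflow 1 lo rest (s≤s z≤n) m
  ... | p , m′ = cong (true ∷_) p , m′
  park-++-overflow (suc zero) (true ∷ lo) rest _ m with park-++-overflow 1 lo rest (s≤s z≤n) m
  ... | p , m′ = cong (true ∷_) p , m′

  park-++-beyond : ∀ lo rest d →
    park (length lo + suc d) (lo ++ rest) ≡ lo ++ park (suc d) rest
    × miss (length lo + suc d) (lo ++ rest) ≡ miss (suc d) rest
  park-++-beyond [] rest d = refl , refl
  park-++-beyond (x ∷ lo) rest d with park-++-beyond lo rest d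
  ... | p , m rewrite +-suc (length lo) d = cong (x ∷_) p , m

  occupied : List Bool → ℕ
  occupied [] = 0
  occupied (true ∷ o) = suc (occupied o)
  occupied (false ∷ o) = occupied o

  vacant : List Bool → ℕ
  vacant [] = 0
  vacant (true ∷ o) = vacant o
  vacant (false ∷ o) = suc (vacant o)

  occupied+vacant : ∀ o → occupied o + vacant o ≡ length o
  occupied+vacant [] = refl
  occupied+vacant (true ∷ o) = cong suc (occupied+vacant o)
  occupied+vacant (false ∷ o) = trans (+-suc (occupied o) _) (cong suc (occupied+vacant o))

  occupied≤length : ∀ o → occupied o ≤ length o
  occupied≤length [] = z≤n
  occupied≤length (true ∷ o) = s≤s (occupied≤length o)
  occupied≤length (false ∷ o) = m≤n⇒m≤1+n (occupied≤length o)

  occupied-empty : ∀ m → occupied (empty m) ≡ 0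
  occupied-empty zero = refl
  occupied-empty (suc m) = occupied-empty m

  occupied-park : ∀ a o → occupied (park a o) + miss a o ≡ suc (occupied o)
  occupied-park a [] = refl
  occupied-park (suc (suc a)) (true ∷ o) = cong suc (occupied-park (suc a) o)
  occupied-park (suc (suc a)) (false ∷ o) = occupied-park (suc a) o
  occupied-park zero (true ∷ o) = cong suc (occupied-park 1 o)
  occupied-park (suc zero) (true ∷ o) = cong suc (occupied-park 1 o)
  occupied-park zero (false ∷ o) = cong suc (+-identityʳ (occupied o))
  occupied-park (suc zero) (false ∷ o) = cong suc (+-identityʳ (occupied o))

  misses+occupied : ∀ o b → misses o b + occupied (occupancy o b) ≡ length b + occupied o
  misses+occupied o [] = refl
  misses+occupied o (a ∷ b) = begin
    miss a o + misses (park a o) b + occupied (occupancy (park a o) b)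
      ≡⟨ +-assoc (miss a o) _ _ ⟩
    miss a o + (misses (park a o) b + occupied (occupancy (park a o) b))
      ≡⟨ cong (miss a o +_) (misses+occupied (park a o) b) ⟩
    miss a o + (length b + occupied (park a o))
      ≡⟨ trans (+-comm (miss a o) _) (+-assoc (length b) _ _) ⟩
    length b + (occupied (park a o) + miss a o)
      ≡⟨ cong (length b +_) (occupied-park a o) ⟩
    length b + suc (occupied o)
      ≡⟨ +-suc (length b) _ ⟩
    suc (length b) + occupied o ∎
    where open ≡-Reasoning

  misses+occupied-empty : ∀ m b → misses (empty m) b + occupied (occupancy (empty m) b) ≡ length b
  misses+occupied-empty m b =
    trans (misses+occupied (empty m) b) (trans (cong (length b +_) (occupied-empty m)) (+-identityʳ _))

  miss-1≡full : ∀ o → miss 1 o ≡ indicator (and o)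
  miss-1≡full [] = refl
  miss-1≡full (true ∷ o) = miss-1≡full o
  miss-1≡full (false ∷ o) = refl

  full⇒occupied≡length : ∀ o → and o ≡ true → occupied o ≡ length o
  full⇒occupied≡length [] _ = refl
  full⇒occupied≡length (true ∷ o) e = cong suc (full⇒occupied≡length o e)

  occupied≡length⇒full : ∀ o → occupied o ≡ length o → and o ≡ true
  occupied≡length⇒full [] _ = refl
  occupied≡length⇒full (true ∷ o) e = occupied≡length⇒full o (suc-injective e)
  occupied≡length⇒full (false ∷ o) e = ⊥-elim (<-irrefl e (s≤s (occupied≤length o)))

  full⇒vacant≡0 : ∀ o → and o ≡ true → vacant o ≡ 0
  full⇒vacant≡0 [] _ = refl
  full⇒vacant≡0 (true ∷ o) e = full⇒vacant≡0 o e

  and-snoc : ∀ o x → and (o ++ [ x ]) ≡ and o ∧ x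
  and-snoc [] x = ∧-identityʳ x
  and-snoc (true ∷ o) x = and-snoc o x
  and-snoc (false ∷ o) x = refl

  -- Spaces beyond the end of the list count as occupied.
  firstOccupied : List Bool → Bool
  firstOccupied [] = true
  firstOccupied (c ∷ _) = c

  park-keeps-occupied : ∀ n a o → firstOccupied (drop n o) ≡ true → firstOccupied (drop n (park a o)) ≡ true
  park-keeps-occupied n a [] e = e
  park-keeps-occupied zero (suc (suc a)) (true ∷ o) e = refl
  park-keeps-occupied zero zero (true ∷ o) e = refl
  park-keeps-occupied zero (suc zero) (true ∷ o) e = refl
  park-keeps-occupied (suc n) (suc (suc a)) (x ∷ o) e = park-keeps-occupied n (suc a) o e
  park-keeps-occupied (suc n) zero (true ∷ o) e = park-keeps-occupied n 1 o e
  park-keeps-occupied (suc n) (suc zero) (true ∷ o) e = park-keeps-occupied n 1 o e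
  park-keeps-occupied (suc n) zero (false ∷ o) e = e
  park-keeps-occupied (suc n) (suc zero) (false ∷ o) e = e

  occupancy-keeps-occupied : ∀ n o b → firstOccupied (drop n o) ≡ true → firstOccupied (drop n (occupancy o b)) ≡ true
  occupancy-keeps-occupied n o [] e = e
  occupancy-keeps-occupied n o (a ∷ b) e = occupancy-keeps-occupied n (park a o) b (park-keeps-occupied n a o e)

  drop-length-++ : ∀ (lo r : List Bool) → drop (length lo) (lo ++ r) ≡ r
  drop-length-++ [] r = refl
  drop-length-++ (x ∷ lo) r = drop-length-++ lo r

  take-length-++ : ∀ (lo r : List Bool) → take (length lo) (lo ++ r) ≡ lo
  take-length-++ [] r = refl
  take-length-++ (x ∷ lo) r = cong (x ∷_) (take-length-++ lo r)

  All≤-mono : ∀ {m n} → m ≤ n → (b : List ℕ) → All (_≤ m) b → All (_≤ n) b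
  All≤-mono m≤n b = All.map (λ a≤m → ≤-trans a≤m m≤n)

  -- An extra space at the far end: if it starts occupied, nothing changes; if it starts
  -- vacant, the first car that would have failed takes it instead.
  misses-snoc-occupied : ∀ o b → All (_≤ length o) b →
    misses (o ++ [ true ]) b ≡ misses o b × occupancy (o ++ [ true ]) b ≡ occupancy o b ++ [ true ]
  misses-snoc-occupied o [] _ = refl , refl
  misses-snoc-occupied o (a ∷ b) (a≤ ∷ b≤) with miss≡0⊎miss≡1 a o
  ... | inj₁ m0 with park-++-inside a o [ true ] m0
  ...   | p , m rewrite p | m | m0 =
    misses-snoc-occupied (park a o) b (subst (λ n → All (_≤ n) b) (sym (length-park a o)) b≤)
  misses-snoc-occupied o (a ∷ b) (a≤ ∷ b≤) | inj₂ m1 with park-++-overflow a o [ true ] (m≤n⇒m≤1+n a≤) m1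
  ...   | p , m rewrite p | m | m1 | miss≡1⇒park≡id a o m1 =
    cong suc (proj₁ (misses-snoc-occupied o b b≤)) , proj₂ (misses-snoc-occupied o b b≤)

  misses-snoc-vacant : ∀ o b → All (_≤ length o) b →
    misses (o ++ [ false ]) b ≡ misses o b ∸ 1
    × occupancy (o ++ [ false ]) b ≡ occupancy o b ++ [ not (misses o b ≡ᵇ 0) ]
  misses-snoc-vacant o [] _ = refl , refl
  misses-snoc-vacant o (a ∷ b) (a≤ ∷ b≤) with miss≡0⊎miss≡1 a o
  ... | inj₁ m0 with park-++-inside a o [ false ] m0
  ...   | p , m rewrite p | m | m0 =
    misses-snoc-vacant (park a o) b (subst (λ n → All (_≤ n) b) (sym (length-park a o)) b≤)
  misses-snoc-vacant o (a ∷ b) (a≤ ∷ b≤) | inj₂ m1 with park-++-overflow a o [ false ] (m≤n⇒m≤1+n a≤) m1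
  ...   | p , m rewrite p | m | m1 | miss≡1⇒park≡id a o m1 = misses-snoc-occupied o b b≤

  replicate-snoc : ∀ e (x : Bool) → replicate (suc e) x ≡ replicate e x ++ [ x ]
  replicate-snoc zero x = refl
  replicate-snoc (suc e) x = cong (x ∷_) (replicate-snoc e x)

  empty-+ : ∀ a c → empty (a + c) ≡ empty a ++ empty c
  empty-+ zero c = refl
  empty-+ (suc a) c = cong (false ∷_) (empty-+ a c)

  empty-split : ∀ a c → empty (a + suc c) ≡ empty a ++ false ∷ empty c
  empty-split a c = empty-+ a (suc c)

  pad-snoc : ∀ o e → o ++ empty (suc e) ≡ (o ++ empty e) ++ [ false ]
  pad-snoc o e = trans (cong (o ++_) (replicate-snoc e false)) (sym (++-assoc o (empty e) [ false ]))

  length≤length-pad : ∀ o e → length o ≤ length (o ++ empty e)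
  length≤length-pad o e = subst (length o ≤_) (sym (length-++ o)) (m≤m+n (length o) _)

  misses-pad : ∀ o e b → All (_≤ length o) b → misses (o ++ empty e) b ≡ misses o b ∸ e
  misses-pad o zero b _ = cong (λ z → misses z b) (++-identityʳ o)
  misses-pad o (suc e) b b≤ = begin
    misses (o ++ empty (suc e)) b           ≡⟨ cong (λ z → misses z b) (pad-snoc o e) ⟩
    misses ((o ++ empty e) ++ [ false ]) b  ≡⟨ proj₁ (misses-snoc-vacant (o ++ empty e) b (All≤-mono (length≤length-pad o e) b b≤)) ⟩
    misses (o ++ empty e) b ∸ 1             ≡⟨ cong (_∸ 1) (misses-pad o e b b≤) ⟩
    misses o b ∸ e ∸ 1                      ≡⟨ ∸-+-assoc (misses o b) e 1 ⟩
    misses o b ∸ (e + 1)                    ≡⟨ cong (misses o b ∸_) (+-comm e 1) ⟩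
    misses o b ∸ suc e                      ∎
    where open ≡-Reasoning

  vacantThenFull : List Bool → Bool
  vacantThenFull [] = false
  vacantThenFull (c ∷ rest) = not c ∧ and rest

  -- Space l, numbered from 1 and so at index l ∸ 1, is the last vacant space.
  lastVacant : ℕ → List Bool → Bool
  lastVacant l o = vacantThenFull (drop (l ∸ 1) o)

  vacantThenFull⇒vacant≡1 : ∀ d → vacantThenFull d ≡ true → vacant d ≡ 1
  vacantThenFull⇒vacant≡1 (false ∷ rest) e = cong suc (full⇒vacant≡0 rest e)

  firstOccupied⇒¬vacantThenFull : ∀ d → firstOccupied d ≡ true → vacantThenFull d ≡ false
  firstOccupied⇒¬vacantThenFull [] _ = refl
  firstOccupied⇒¬vacantThenFull (true ∷ d) _ = refl

  vacantThenFull-snoc : ∀ c d x → vacantThenFull ((c ∷ d) ++ [ x ]) ≡ vacantThenFull (c ∷ d) ∧ x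
  vacantThenFull-snoc true d x = refl
  vacantThenFull-snoc false d x = and-snoc d x

  drop-snoc : ∀ n (o : List Bool) x → n ≤ length o → drop n (o ++ [ x ]) ≡ drop n o ++ [ x ]
  drop-snoc zero o x _ = refl
  drop-snoc (suc n) (c ∷ o) x (s≤s n≤) = drop-snoc n o x n≤

  lastVacant-snoc : ∀ l o x → 1 ≤ l → l ≤ length o → lastVacant l (o ++ [ x ]) ≡ lastVacant l o ∧ x
  lastVacant-snoc (suc l) o x _ l< = trans (cong vacantThenFull (drop-snoc l o x (<⇒≤ l<))) (snoc l o l<)
    where
      snoc : ∀ n o → n < length o → vacantThenFull (drop n o ++ [ x ]) ≡ vacantThenFull (drop n o) ∧ x
      snoc zero (c ∷ o) _ = vacantThenFull-snoc c o x
      snoc (suc n) (c ∷ o) (s≤s n<) = snoc n o n<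

  lastVacant-shift : ∀ (lo : List Bool) x hi L → suc (length lo) < L →
    lastVacant L (lo ++ x ∷ hi) ≡ lastVacant (L ∸ suc (length lo)) hi
  lastVacant-shift [] x hi (suc (suc L)) _ = refl
  lastVacant-shift (y ∷ lo) x hi (suc (suc (suc L))) (s≤s lt) = lastVacant-shift lo x hi (suc (suc L)) lt
  lastVacant-shift [] x hi (suc zero) (s≤s ())
  lastVacant-shift (y ∷ lo) x hi (suc (suc zero)) (s≤s (s≤s ()))

  misses-lastVacant-pad : ∀ e j o b l → All (_≤ length o) b → 1 ≤ l → l ≤ length o →
    (misses (o ++ empty e) b ≡ᵇ j) ∧ lastVacant l (occupancy (o ++ empty e) b)
      ≡ (misses o b ≡ᵇ e + j) ∧ lastVacant l (occupancy o b)
  misses-lastVacant-pad zero j o b l _ _ _ =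
    cong (λ z → (misses z b ≡ᵇ j) ∧ lastVacant l (occupancy z b)) (++-identityʳ o)
  misses-lastVacant-pad (suc e) j o b l b≤ 1≤l l≤ = begin
    (misses (o ++ empty (suc e)) b ≡ᵇ j) ∧ lastVacant l (occupancy (o ++ empty (suc e)) b)
      ≡⟨ cong (λ z → (misses z b ≡ᵇ j) ∧ lastVacant l (occupancy z b)) (pad-snoc o e) ⟩
    (misses (oe ++ [ false ]) b ≡ᵇ j) ∧ lastVacant l (occupancy (oe ++ [ false ]) b)
      ≡⟨ cong₂ (λ F O → (F ≡ᵇ j) ∧ lastVacant l O) (proj₁ snoc) (proj₂ snoc) ⟩
    (misses oe b ∸ 1 ≡ᵇ j) ∧ lastVacant l (occupancy oe b ++ [ not (misses oe b ≡ᵇ 0) ])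
      ≡⟨ cong ((misses oe b ∸ 1 ≡ᵇ j) ∧_) (lastVacant-snoc l (occupancy oe b) _ 1≤l l≤oe) ⟩
    (misses oe b ∸ 1 ≡ᵇ j) ∧ (lastVacant l (occupancy oe b) ∧ not (misses oe b ≡ᵇ 0))
      ≡⟨ pred-step (misses oe b) (lastVacant l (occupancy oe b)) ⟩
    (misses oe b ≡ᵇ suc j) ∧ lastVacant l (occupancy oe b)
      ≡⟨ misses-lastVacant-pad e (suc j) o b l b≤ 1≤l l≤ ⟩
    (misses o b ≡ᵇ e + suc j) ∧ lastVacant l (occupancy o b)
      ≡⟨ cong (λ z → (misses o b ≡ᵇ z) ∧ lastVacant l (occupancy o b)) (+-suc e j) ⟩
    (misses o b ≡ᵇ suc e + j) ∧ lastVacant l (occupancy o b) ∎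
    where
      open ≡-Reasoning
      oe = o ++ empty e
      snoc = misses-snoc-vacant oe b (All≤-mono (length≤length-pad o e) b b≤)
      l≤oe : l ≤ length (occupancy oe b)
      l≤oe = ≤-trans l≤ (≤-trans (length≤length-pad o e) (≤-reflexive (sym (length-occupancy oe b))))
      pred-step : ∀ F L → (F ∸ 1 ≡ᵇ j) ∧ (L ∧ not (F ≡ᵇ 0)) ≡ (F ≡ᵇ suc j) ∧ L
      pred-step zero L = trans (cong ((0 ≡ᵇ j) ∧_) (∧-zeroʳ L)) (∧-zeroʳ _)
      pred-step (suc F) L = cong ((F ≡ᵇ j) ∧_) (∧-identityʳ L)

  miss-mono : ∀ a t o → a ≤ t → miss a o ≡ 1 → miss t o ≡ 1
  miss-mono a t [] _ _ = refl
  miss-mono (suc (suc a)) (suc (suc t)) (x ∷ o) (s≤s a≤t) m = miss-mono (suc a) (suc t) o a≤t m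
  miss-mono (suc (suc a)) (suc zero) (x ∷ o) (s≤s ()) m
  miss-mono zero zero (true ∷ o) _ m = m
  miss-mono zero (suc zero) (true ∷ o) _ m = m
  miss-mono zero (suc (suc t)) (true ∷ o) _ m = miss-mono 1 (suc t) o (s≤s z≤n) m
  miss-mono (suc zero) (suc zero) (true ∷ o) _ m = m
  miss-mono (suc zero) (suc (suc t)) (true ∷ o) _ m = miss-mono 1 (suc t) o (s≤s z≤n) m

  miss-park : ∀ t c o → miss t o ≡ 1 → miss t (park c o) ≡ 1
  miss-park t c [] m = m
  miss-park (suc (suc t)) (suc (suc c)) (x ∷ o) m = miss-park (suc t) (suc c) o m
  miss-park (suc (suc t)) zero (true ∷ o) m = miss-park (suc t) 1 o m
  miss-park (suc (suc t)) (suc zero) (true ∷ o) m = miss-park (suc t) 1 o m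
  miss-park (suc (suc t)) zero (false ∷ o) m = m
  miss-park (suc (suc t)) (suc zero) (false ∷ o) m = m
  miss-park zero (suc (suc c)) (true ∷ o) m = miss-park 1 (suc c) o m
  miss-park zero zero (true ∷ o) m = miss-park 1 1 o m
  miss-park zero (suc zero) (true ∷ o) m = miss-park 1 1 o m
  miss-park (suc zero) (suc (suc c)) (true ∷ o) m = miss-park 1 (suc c) o m
  miss-park (suc zero) zero (true ∷ o) m = miss-park 1 1 o m
  miss-park (suc zero) (suc zero) (true ∷ o) m = miss-park 1 1 o m

  miss-occupancy : ∀ t o b → miss t o ≡ 1 → miss t (occupancy o b) ≡ 1
  miss-occupancy t o [] m = m
  miss-occupancy t o (a ∷ b) m = miss-occupancy t (park a o) b (miss-park t a o m)

  -- A failed car with preference a ≤ t found spaces a, a + 1, … full, and they stay full.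
  misses≥1⇒miss : ∀ t o b → All (_≤ t) b → 1 ≤ misses o b → miss t (occupancy o b) ≡ 1
  misses≥1⇒miss t o (a ∷ b) (a≤t ∷ b≤t) ≥1 with miss≡0⊎miss≡1 a o
  ... | inj₂ m1 = miss-occupancy t (park a o) b (miss-park t a o (miss-mono a t o a≤t m1))
  ... | inj₁ m0 rewrite m0 = misses≥1⇒miss t (park a o) b b≤t ≥1

  -- Sums over preference sequences

  Σ< : ℕ → (ℕ → ℕ) → ℕ
  Σ< zero f = 0
  Σ< (suc n) f = f 0 + Σ< n (f ∘ suc)

  Σ≤ : ℕ → (ℕ → ℕ) → ℕ
  Σ≤ t f = Σ< t (f ∘ suc)

  ΣSeq : ℕ → ℕ → (List ℕ → ℕ) → ℕ
  ΣSeq zero t F = F []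
  ΣSeq (suc N) t F = Σ≤ t (λ a → ΣSeq N t (F ∘ (a ∷_)))

  Σ<-cong : ∀ n {f g} → (∀ a → a < n → f a ≡ g a) → Σ< n f ≡ Σ< n g
  Σ<-cong zero _ = refl
  Σ<-cong (suc n) f≗g = cong₂ _+_ (f≗g 0 (s≤s z≤n)) (Σ<-cong n (λ a a<n → f≗g (suc a) (s≤s a<n)))

  Σ<-0 : ∀ n → Σ< n (λ _ → 0) ≡ 0
  Σ<-0 zero = refl
  Σ<-0 (suc n) = Σ<-0 n

  Σ<-+ : ∀ n f g → Σ< n (λ a → f a + g a) ≡ Σ< n f + Σ< n g
  Σ<-+ zero f g = refl
  Σ<-+ (suc n) f g = begin
    f 0 + g 0 + Σ< n (λ a → f (suc a) + g (suc a)) ≡⟨ cong (f 0 + g 0 +_) (Σ<-+ n (f ∘ suc) (g ∘ suc)) ⟩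
    f 0 + g 0 + (Σ< n (f ∘ suc) + Σ< n (g ∘ suc)) ≡⟨ +-assoc (f 0) (g 0) _ ⟩
    f 0 + (g 0 + (Σ< n (f ∘ suc) + Σ< n (g ∘ suc))) ≡⟨ cong (f 0 +_) (x+[y+z]≡y+[x+z] (g 0) (Σ< n (f ∘ suc)) (Σ< n (g ∘ suc))) ⟩
    f 0 + (Σ< n (f ∘ suc) + (g 0 + Σ< n (g ∘ suc))) ≡⟨ sym (+-assoc (f 0) _ _) ⟩
    f 0 + Σ< n (f ∘ suc) + (g 0 + Σ< n (g ∘ suc)) ∎
    where
      open ≡-Reasoning
      x+[y+z]≡y+[x+z] : ∀ x y z → x + (y + z) ≡ y + (x + z)
      x+[y+z]≡y+[x+z] x y z = trans (sym (+-assoc x y z)) (trans (cong (_+ z) (+-comm x y)) (+-assoc y x z))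

  Σ<-* : ∀ n c f → Σ< n (λ a → c * f a) ≡ c * Σ< n f
  Σ<-* zero c f = sym (*-zeroʳ c)
  Σ<-* (suc n) c f = trans (cong (c * f 0 +_) (Σ<-* n c (f ∘ suc))) (sym (*-distribˡ-+ c (f 0) _))

  Σ<-split : ∀ x y f → Σ< (x + y) f ≡ Σ< x f + Σ< y (λ a → f (x + a))
  Σ<-split zero y f = refl
  Σ<-split (suc x) y f = trans (cong (f 0 +_) (Σ<-split x y (f ∘ suc))) (sym (+-assoc (f 0) _ _))

  Σ<-single : ∀ n r f → r < n → (∀ a → a < n → a ≢ r → f a ≡ 0) → Σ< n f ≡ f r
  Σ<-single (suc n) zero f _ f≡0 = trans (cong (f 0 +_) rest≡0) (+-identityʳ (f 0))
    where rest≡0 = trans (Σ<-cong n (λ a a<n → f≡0 (suc a) (s≤s a<n) (λ ()))) (Σ<-0 n)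
  Σ<-single (suc n) (suc r) f (s≤s r<n) f≡0 =
    trans (cong (_+ Σ< n (f ∘ suc)) (f≡0 0 (s≤s z≤n) (λ ())))
          (Σ<-single n r (f ∘ suc) r<n (λ a a<n a≢r → f≡0 (suc a) (s≤s a<n) (λ e → a≢r (suc-injective e))))

  ΣSeq-cong : ∀ N t {F G} → (∀ b → length b ≡ N → All (_≤ t) b → F b ≡ G b) → ΣSeq N t F ≡ ΣSeq N t G
  ΣSeq-cong zero t F≗G = F≗G [] refl []
  ΣSeq-cong (suc N) t F≗G = Σ<-cong t (λ a a<t →
    ΣSeq-cong N t (λ b lb b≤t → F≗G (suc a ∷ b) (cong suc lb) (a<t ∷ b≤t)))

  ΣSeq-0 : ∀ N t → ΣSeq N t (λ _ → 0) ≡ 0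
  ΣSeq-0 zero t = refl
  ΣSeq-0 (suc N) t = trans (Σ<-cong t (λ a _ → ΣSeq-0 N t)) (Σ<-0 t)

  ΣSeq-+ : ∀ N t F G → ΣSeq N t (λ b → F b + G b) ≡ ΣSeq N t F + ΣSeq N t G
  ΣSeq-+ zero t F G = refl
  ΣSeq-+ (suc N) t F G =
    trans (Σ<-cong t (λ a _ → ΣSeq-+ N t (F ∘ (suc a ∷_)) (G ∘ (suc a ∷_))))
          (Σ<-+ t (λ a → ΣSeq N t (F ∘ (suc a ∷_))) (λ a → ΣSeq N t (G ∘ (suc a ∷_))))

  ΣSeq-Σ< : ∀ N t K (f : ℕ → List ℕ → ℕ) → ΣSeq N t (λ b → Σ< K (λ j → f j b)) ≡ Σ< K (λ j → ΣSeq N t (f j))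
  ΣSeq-Σ< N t zero f = ΣSeq-0 N t
  ΣSeq-Σ< N t (suc K) f = trans (ΣSeq-+ N t (f 0) (λ b → Σ< K (λ j → f (suc j) b)))
                                (cong (ΣSeq N t (f 0) +_) (ΣSeq-Σ< N t K (f ∘ suc)))

  sum-map-concatMap : ∀ {A B : Set} (F : B → ℕ) (g : A → List B) xs →
    sum (map F (concatMap g xs)) ≡ sum (map (λ x → sum (map F (g x))) xs)
  sum-map-concatMap F g [] = refl
  sum-map-concatMap F g (x ∷ xs) = begin
    sum (map F (g x ++ concatMap g xs))              ≡⟨ cong sum (map-++ F (g x) _) ⟩
    sum (map F (g x) ++ map F (concatMap g xs))      ≡⟨ sum-++ (map F (g x)) _ ⟩
    sum (map F (g x)) + sum (map F (concatMap g xs)) ≡⟨ cong (sum (map F (g x)) +_) (sum-map-concatMap F g xs) ⟩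
    sum (map F (g x)) + sum (map (λ x → sum (map F (g x))) xs) ∎
    where open ≡-Reasoning

  sum-map-applyUpTo : ∀ (h f : ℕ → ℕ) r → sum (map h (applyUpTo f r)) ≡ Σ< r (h ∘ f)
  sum-map-applyUpTo h f zero = refl
  sum-map-applyUpTo h f (suc r) = cong (h (f 0) +_) (sum-map-applyUpTo h (f ∘ suc) r)

  sum-map-seqs : ∀ N t F → sum (map F (seqs N t)) ≡ ΣSeq N t F
  sum-map-seqs zero t F = +-identityʳ (F [])
  sum-map-seqs (suc N) t F = begin
    sum (map F (concatMap (λ a → map (a ∷_) (seqs N t)) (map suc (upTo t))))
      ≡⟨ sum-map-concatMap F _ (map suc (upTo t)) ⟩
    sum (map (λ a → sum (map F (map (a ∷_) (seqs N t)))) (map suc (upTo t)))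
      ≡⟨ cong sum (sym (map-∘ (upTo t))) ⟩
    sum (map (λ a → sum (map F (map (suc a ∷_) (seqs N t)))) (upTo t))
      ≡⟨ sum-map-applyUpTo _ (λ a → a) t ⟩
    Σ< t (λ a → sum (map F (map (suc a ∷_) (seqs N t))))
      ≡⟨ Σ<-cong t (λ a _ → trans (cong sum (sym (map-∘ (seqs N t)))) (sum-map-seqs N t _)) ⟩
    ΣSeq (suc N) t F ∎
    where open ≡-Reasoning

  p≡ΣSeq : ∀ N m t k → p N m t k ≡ ΣSeq N (m ⊓ t) (λ b → indicator (misses (empty m) b ≡ᵇ k))
  p≡ΣSeq N m t k = trans (sum-map-seqs N (m ⊓ t) _)
    (ΣSeq-cong N _ (λ b _ _ → cong (λ z → indicator (z ≡ᵇ k)) (flawsFrom≡misses (empty m) b)))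

  pr≡ΣSeq : ∀ r N m t k → 1 ≤ r → r ≤ m ⊓ t →
    pr r (suc N) m t k ≡ ΣSeq N (m ⊓ t) (λ b → indicator (misses (empty m) (r ∷ b) ≡ᵇ k))
  pr≡ΣSeq (suc r) N m t k _ r<t = begin
    pr (suc r) (suc N) m t k
      ≡⟨ sum-map-seqs (suc N) (m ⊓ t) _ ⟩
    Σ< (m ⊓ t) (λ a → ΣSeq N (m ⊓ t) (λ b → if suc a ≡ᵇ suc r then count (suc a ∷ b) else 0))
      ≡⟨ Σ<-cong (m ⊓ t) (λ a _ → ΣSeq-if (a ≡ᵇ r)) ⟩
    Σ< (m ⊓ t) (λ a → if a ≡ᵇ r then ΣSeq N (m ⊓ t) (count ∘ (suc a ∷_)) else 0)
      ≡⟨ Σ<-single (m ⊓ t) r _ r<t (λ a _ a≢r →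
           cong (λ c → if c then ΣSeq N (m ⊓ t) (count ∘ (suc a ∷_)) else 0) (≢⇒≡ᵇ≡false a r a≢r)) ⟩
    (if r ≡ᵇ r then ΣSeq N (m ⊓ t) (count ∘ (suc r ∷_)) else 0)
      ≡⟨ cong (λ c → if c then ΣSeq N (m ⊓ t) (count ∘ (suc r ∷_)) else 0) (≡ᵇ-refl r) ⟩
    ΣSeq N (m ⊓ t) (count ∘ (suc r ∷_))
      ≡⟨ ΣSeq-cong N _ (λ b _ _ → cong (λ z → indicator (z ≡ᵇ k)) (flawsFrom≡misses (empty m) (suc r ∷ b))) ⟩
    ΣSeq N (m ⊓ t) (λ b → indicator (misses (empty m) (suc r ∷ b) ≡ᵇ k)) ∎
    where
      open ≡-Reasoning
      count : List ℕ → ℕ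
      count as = indicator (flaws m as ≡ᵇ k)
      ΣSeq-if : ∀ {a} c → ΣSeq N (m ⊓ t) (λ b → if c then count (suc a ∷ b) else 0)
                          ≡ (if c then ΣSeq N (m ⊓ t) (count ∘ (suc a ∷_)) else 0)
      ΣSeq-if true = refl
      ΣSeq-if false = ΣSeq-0 N (m ⊓ t)

  -- Cutting the spaces at a vacant space

  data Side : Set where
    below atGap : Side
    above : ℕ → Side

  side : ℕ → ℕ → Side
  side zero zero = atGap
  side zero (suc g) = below
  side (suc a) zero = above a
  side (suc a) (suc g) = side a g

  side≡below⇒< : ∀ a g → side a g ≡ below → a < g
  side≡below⇒< zero (suc g) _ = s≤s z≤n
  side≡below⇒< (suc a) (suc g) e = s≤s (side≡below⇒< a g e)

  side≡atGap⇒≡ : ∀ a g → side a g ≡ atGap → a ≡ g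
  side≡atGap⇒≡ zero zero _ = refl
  side≡atGap⇒≡ (suc a) (suc g) e = cong suc (side≡atGap⇒≡ a g e)

  side≡above⇒≡ : ∀ a g d → side a g ≡ above d → a ≡ g + suc d
  side≡above⇒≡ (suc a) zero d refl = refl
  side≡above⇒≡ (suc a) (suc g) d e = cong suc (side≡above⇒≡ a g d e)

  <⇒side≡below : ∀ a g → a < g → side a g ≡ below
  <⇒side≡below zero (suc g) _ = refl
  <⇒side≡below (suc a) (suc g) (s≤s a<g) = <⇒side≡below a g a<g

  side-atGap : ∀ g → side g g ≡ atGap
  side-atGap zero = refl
  side-atGap (suc g) = side-atGap g

  side-above : ∀ g d → side (g + suc d) g ≡ above d
  side-above zero d = refl
  side-above (suc g) d = side-above g d

  consBelow : Side → ℕ → List ℕ → List ℕ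
  consBelow below a r = a ∷ r
  consBelow atGap a r = r
  consBelow (above _) a r = r

  consAbove : Side → List ℕ → List ℕ
  consAbove (above d) r = suc d ∷ r
  consAbove below r = r
  consAbove atGap r = r

  orAtGap : Side → Bool → Bool
  orAtGap atGap _ = true
  orAtGap below h = h
  orAtGap (above _) h = h

  -- Relative to a gap at space g, a preference sequence splits into the preferences below g and
  -- those above g (shifted down by g); no car may prefer g itself.
  prefsBelow : ℕ → List ℕ → List ℕ
  prefsBelow g [] = []
  prefsBelow g (a ∷ b) = consBelow (side a g) a (prefsBelow g b)

  prefsAbove : ℕ → List ℕ → List ℕ
  prefsAbove g [] = []
  prefsAbove g (a ∷ b) = consAbove (side a g) (prefsAbove g b)

  hitsGap : ℕ → List ℕ → Bool
  hitsGap g [] = false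
  hitsGap g (a ∷ b) = orAtGap (side a g) (hitsGap g b)

  gapSurvives : ℕ → List ℕ → List Bool → Bool
  gapSurvives g b lo = not (hitsGap g b) ∧ (misses lo (prefsBelow g b) ≡ᵇ 0)

  misses-∷≡0 : ∀ a lo b → misses lo (a ∷ b) ≡ 0 → miss a lo ≡ 0 × misses (park a lo) b ≡ 0
  misses-∷≡0 a lo b e with miss a lo
  ... | zero = refl , e

  park-++-gap-above : ∀ lo hi d →
    park (suc (length lo) + suc d) (lo ++ false ∷ hi) ≡ lo ++ false ∷ park (suc d) hi
    × miss (suc (length lo) + suc d) (lo ++ false ∷ hi) ≡ miss (suc d) hi
  park-++-gap-above lo hi d with park-++-beyond lo (false ∷ hi) (suc d)
  ... | p , m rewrite +-suc (length lo) (suc d) = p , m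

  park-++-gap : ∀ lo hi → park (suc (length lo)) (lo ++ false ∷ hi) ≡ lo ++ true ∷ hi
  park-++-gap lo hi with park-++-beyond lo (false ∷ hi) 0
  ... | p , _ rewrite +-comm (length lo) 1 = p

  park-split-at-gap : ∀ g b lo hi → g ≡ suc (length lo) → hitsGap g b ≡ false →
    misses lo (prefsBelow g b) ≡ 0 →
    occupancy (lo ++ false ∷ hi) b ≡ occupancy lo (prefsBelow g b) ++ false ∷ occupancy hi (prefsAbove g b)
    × misses (lo ++ false ∷ hi) b ≡ misses hi (prefsAbove g b)
  park-split-at-gap g [] lo hi _ _ _ = refl , refl
  park-split-at-gap g (a ∷ b) lo hi g≡ hits ms with side a g in s
  ... | below with misses-∷≡0 a lo (prefsBelow g b) ms
  ...   | m0 , ms′ with park-++-inside a lo (false ∷ hi) m0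
  ...     | p , m rewrite p | m =
    park-split-at-gap g b (park a lo) hi (trans g≡ (cong suc (sym (length-park a lo)))) hits ms′
  park-split-at-gap g (a ∷ b) lo hi g≡ () ms | atGap
  park-split-at-gap g (a ∷ b) lo hi g≡ hits ms | above d with park-++-gap-above lo hi d
  ... | p , m rewrite side≡above⇒≡ a g d s | g≡ | p | m
        with park-split-at-gap (suc (length lo)) b lo (park (suc d) hi) refl hits ms
  ...   | o≡ , m≡ = o≡ , cong (miss (suc d) hi +_) m≡

  filled-gap-stays-filled : ∀ lo hi b →
    firstOccupied (drop (length lo) (occupancy (lo ++ true ∷ hi) b)) ≡ true
  filled-gap-stays-filled lo hi b =
    occupancy-keeps-occupied (length lo) (lo ++ true ∷ hi) b (cong firstOccupied (drop-length-++ lo (true ∷ hi)))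

  gap-occupied : ∀ g b lo hi → g ≡ suc (length lo) → gapSurvives g b lo ≡ false →
    firstOccupied (drop (length lo) (occupancy (lo ++ false ∷ hi) b)) ≡ true
  gap-occupied g [] lo hi _ ()
  gap-occupied g (a ∷ b) lo hi g≡ gs with side a g in s
  ... | atGap rewrite side≡atGap⇒≡ a g s | g≡ | park-++-gap lo hi = filled-gap-stays-filled lo hi b
  ... | above d with park-++-gap-above lo hi d
  ...   | p , _ rewrite side≡above⇒≡ a g d s | g≡ | p =
    gap-occupied (suc (length lo)) b lo (park (suc d) hi) refl gs
  gap-occupied g (a ∷ b) lo hi g≡ gs | below with miss≡0⊎miss≡1 a lo
  ... | inj₁ m0 rewrite m0 with park-++-inside a lo (false ∷ hi) m0
  ...   | p , _ rewrite p =
    subst (λ n → firstOccupied (drop n (occupancy (park a lo ++ false ∷ hi) b)) ≡ true) (length-park a lo)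
          (gap-occupied g b (park a lo) hi (trans g≡ (cong suc (sym (length-park a lo)))) gs)
  gap-occupied g (a ∷ b) lo hi g≡ gs | below | inj₂ m1
    with park-++-overflow a lo (false ∷ hi) (≤-trans (<⇒≤ (side≡below⇒< a g s)) (≤-reflexive g≡)) m1
  ... | p , _ rewrite p = filled-gap-stays-filled lo hi b

  -- The weight of b that sends the j cars below the gap at space g to φ and the rest to ψ.
  byGap : ℕ → ℕ → (List ℕ → ℕ) → (List ℕ → ℕ) → List ℕ → ℕ
  byGap g j φ ψ b = indicator (not (hitsGap g b))
                    * (indicator (length (prefsBelow g b) ≡ᵇ j) * (φ (prefsBelow g b) * ψ (prefsAbove g b)))

  length-prefsBelow≤ : ∀ g b → length (prefsBelow g b) ≤ length b
  length-prefsBelow≤ g [] = z≤n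
  length-prefsBelow≤ g (a ∷ b) with side a g
  ... | below = s≤s (length-prefsBelow≤ g b)
  ... | atGap = m≤n⇒m≤1+n (length-prefsBelow≤ g b)
  ... | above _ = m≤n⇒m≤1+n (length-prefsBelow≤ g b)

  length-prefsBelow+prefsAbove : ∀ g b → hitsGap g b ≡ false →
    length (prefsBelow g b) + length (prefsAbove g b) ≡ length b
  length-prefsBelow+prefsAbove g [] _ = refl
  length-prefsBelow+prefsAbove g (a ∷ b) h with side a g
  ... | below = cong suc (length-prefsBelow+prefsAbove g b h)
  ... | above _ = trans (+-suc (length (prefsBelow g b)) _) (cong suc (length-prefsBelow+prefsAbove g b h))

  byGap-below : ∀ g x j φ ψ b → x < g →
    byGap (suc g) (suc j) φ ψ (suc x ∷ b) ≡ byGap (suc g) j (φ ∘ (suc x ∷_)) ψ b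
  byGap-below g x j φ ψ b x<g rewrite <⇒side≡below x g x<g = refl

  byGap-below-0 : ∀ g x φ ψ b → x < g → byGap (suc g) 0 φ ψ (suc x ∷ b) ≡ 0
  byGap-below-0 g x φ ψ b x<g rewrite <⇒side≡below x g x<g = *-zeroʳ (indicator (not (hitsGap (suc g) b)))

  byGap-atGap : ∀ g j φ ψ b → byGap (suc g) j φ ψ (suc (g + 0) ∷ b) ≡ 0
  byGap-atGap g j φ ψ b rewrite +-identityʳ g | side-atGap g = refl

  byGap-above : ∀ g x j φ ψ b →
    byGap (suc g) j φ ψ (suc (g + suc x) ∷ b) ≡ byGap (suc g) j φ (ψ ∘ (suc x ∷_)) b
  byGap-above g x j φ ψ b rewrite side-above g x = refl

  byGap-short : ∀ g j φ ψ b → length b < j → byGap (suc g) j φ ψ b ≡ 0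
  byGap-short g j φ ψ b b<j with length (prefsBelow (suc g) b) ≡ᵇ j in e
  ... | false = *-zeroʳ (indicator (not (hitsGap (suc g) b)))
  ... | true = ⊥-elim (<-irrefl (≡ᵇ≡true⇒≡ _ j e) (≤-<-trans (length-prefsBelow≤ (suc g) b) b<j))

  Σ<-*-* : ∀ n c d f → Σ< n (λ x → c * f x * d) ≡ c * Σ< n f * d
  Σ<-*-* n c d f = begin
    Σ< n (λ x → c * f x * d)  ≡⟨ Σ<-cong n (λ x _ → trans (*-assoc c (f x) d) (trans (cong (c *_) (*-comm (f x) d)) (sym (*-assoc c d (f x))))) ⟩
    Σ< n (λ x → c * d * f x)  ≡⟨ Σ<-* n (c * d) f ⟩
    c * d * Σ< n f            ≡⟨ trans (*-assoc c d _) (trans (cong (c *_) (*-comm d _)) (sym (*-assoc c _ d))) ⟩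
    c * Σ< n f * d            ∎
    where open ≡-Reasoning

  C-pascal-* : ∀ M j x y → (M C j) * x * y + (M C (suc j)) * x * y ≡ (suc M C suc j) * x * y
  C-pascal-* M j x y = begin
    (M C j) * x * y + (M C (suc j)) * x * y   ≡⟨ *-distribʳ-+ y ((M C j) * x) ((M C (suc j)) * x) ⟨
    ((M C j) * x + (M C (suc j)) * x) * y     ≡⟨ cong (_* y) (*-distribʳ-+ x (M C j) (M C (suc j))) ⟨
    ((M C j) + (M C (suc j))) * x * y         ≡⟨ cong (λ c → c * x * y) (nCk+nC[k+1]≡[n+1]C[k+1] M j) ⟩
    (suc M C suc j) * x * y                   ∎
    where open ≡-Reasoning

  -- Summing over all interleavings: the positions of the j cars below the gap are one of
  -- M C j choices, independently of their preferences and of the preferences of the others.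
  ΣSeq-byGap : ∀ M g u j h (φ ψ : List ℕ → ℕ) → j + h ≡ M →
    ΣSeq M (g + suc u) (byGap (suc g) j φ ψ) ≡ (M C j) * ΣSeq j g φ * ΣSeq h u ψ
  ΣSeq-byGap zero g u zero zero φ ψ _ =
    trans (*-identityˡ (1 * (φ [] * ψ []))) (trans (*-identityˡ (φ [] * ψ [])) (cong (_* ψ []) (sym (*-identityˡ (φ [])))))
  ΣSeq-byGap (suc M) g u j h φ ψ j+h≡ = begin
    Σ< t (λ a → ΣSeq M t (byGap (suc g) j φ ψ ∘ (suc a ∷_)))
      ≡⟨ Σ<-split g (suc u) _ ⟩
    Σ< g (λ x → ΣSeq M t (byGap (suc g) j φ ψ ∘ (suc x ∷_)))
      + (ΣSeq M t (byGap (suc g) j φ ψ ∘ (suc (g + 0) ∷_))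
         + Σ< u (λ x → ΣSeq M t (byGap (suc g) j φ ψ ∘ (suc (g + suc x) ∷_))))
      ≡⟨ cong₂ (λ x y → x + (y + Σ< u (λ x → ΣSeq M t (byGap (suc g) j φ ψ ∘ (suc (g + suc x) ∷_)))))
               (lower j j+h≡) atGap-part ⟩
    Lower j h + (0 + Σ< u (λ x → ΣSeq M t (byGap (suc g) j φ ψ ∘ (suc (g + suc x) ∷_))))
      ≡⟨ cong (Lower j h +_) (upper h j+h≡) ⟩
    Lower j h + Upper j h
      ≡⟨ pascal j h j+h≡ ⟩
    (suc M C j) * ΣSeq j g φ * ΣSeq h u ψ ∎
    where
      open ≡-Reasoning
      t = g + suc u
      Lower Upper : ℕ → ℕ → ℕ
      Lower zero h = 0
      Lower (suc j) h = (M C j) * ΣSeq (suc j) g φ * ΣSeq h u ψ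
      Upper j zero = 0
      Upper j (suc h) = (M C j) * ΣSeq j g φ * ΣSeq (suc h) u ψ
      lower : ∀ j → j + h ≡ suc M → Σ< g (λ x → ΣSeq M t (byGap (suc g) j φ ψ ∘ (suc x ∷_))) ≡ Lower j h
      lower zero _ = trans (Σ<-cong g (λ x x<g → trans (ΣSeq-cong M t (λ b _ _ → byGap-below-0 g x φ ψ b x<g))
                                                        (ΣSeq-0 M t)))
                           (Σ<-0 g)
      lower (suc j) e =
        trans (Σ<-cong g (λ x x<g → trans (ΣSeq-cong M t (λ b _ _ → byGap-below g x j φ ψ b x<g))
                                          (ΣSeq-byGap M g u j h (φ ∘ (suc x ∷_)) ψ (suc-injective e))))
              (Σ<-*-* g (M C j) (ΣSeq h u ψ) (λ x → ΣSeq j g (φ ∘ (suc x ∷_))))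
      atGap-part : ΣSeq M t (byGap (suc g) j φ ψ ∘ (suc (g + 0) ∷_)) ≡ 0
      atGap-part = trans (ΣSeq-cong M t (λ b _ _ → byGap-atGap g j φ ψ b)) (ΣSeq-0 M t)
      upper : ∀ h → j + h ≡ suc M → Σ< u (λ x → ΣSeq M t (byGap (suc g) j φ ψ ∘ (suc (g + suc x) ∷_))) ≡ Upper j h
      upper zero e = trans (Σ<-cong u (λ x _ → trans (ΣSeq-cong M t (λ b lb _ →
                       trans (byGap-above g x j φ ψ b)
                             (byGap-short g j φ (ψ ∘ (suc x ∷_)) b (subst (_< j) (sym lb) (≤-reflexive (trans (sym e) (+-identityʳ j)))))))
                     (ΣSeq-0 M t))) (Σ<-0 u)
      upper (suc h) e =
        trans (Σ<-cong u (λ x _ → trans (ΣSeq-cong M t (λ b _ _ → byGap-above g x j φ ψ b))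
                                        (ΣSeq-byGap M g u j h φ (ψ ∘ (suc x ∷_)) (suc-injective (trans (sym (+-suc j h)) e)))))
              (Σ<-* u ((M C j) * ΣSeq j g φ) (λ x → ΣSeq h u (ψ ∘ (suc x ∷_))))
      pascal : ∀ j h → j + h ≡ suc M → Lower j h + Upper j h ≡ (suc M C j) * ΣSeq j g φ * ΣSeq h u ψ
      pascal zero (suc h) _ = refl
      pascal (suc j) zero e rewrite suc-injective (trans (sym (+-identityʳ (suc j))) e) = begin
        (M C M) * x * y + 0                       ≡⟨ cong ((M C M) * x * y +_) (cong (λ c → c * x * y) (k>n⇒nCk≡0 (n<1+n M))) ⟨
        (M C M) * x * y + (M C suc M) * x * y     ≡⟨ C-pascal-* M M x y ⟩
        (suc M C suc M) * x * y                   ∎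
        where x = ΣSeq (suc M) g φ
              y = ψ []
      pascal (suc j) (suc h) _ = C-pascal-* M j (ΣSeq (suc j) g φ) (ΣSeq (suc h) u ψ)

  -- First preferences and the last vacant space

  lastVacantAfter : ℕ → (ℕ → Bool) → ℕ → List ℕ → ℕ
  lastVacantAfter m P l b = indicator (P (misses (empty m) b) ∧ lastVacant l (occupancy (empty m) b))

  ΣLastVacant : ℕ → ℕ → ℕ → (ℕ → Bool) → ℕ → ℕ
  ΣLastVacant N m t P l = ΣSeq N t (lastVacantAfter m P l)

  miss-at : ∀ r o c rest → drop r o ≡ c ∷ rest →
    miss (suc r) o ≡ miss 1 (c ∷ rest) × miss (suc (suc r)) o ≡ miss 1 rest
  miss-at zero (x ∷ o) c rest refl = refl , refl
  miss-at (suc r) (x ∷ o) c rest e = miss-at r o c rest e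

  drop-∷ : ∀ r (o : List Bool) → r < length o → ∃₂ λ c rest → drop r o ≡ c ∷ rest
  drop-∷ zero (x ∷ o) _ = x , o , refl
  drop-∷ (suc r) (x ∷ o) (s≤s r<) = drop-∷ r o r<

  -- A car preferring r + 2 rather than r + 1 changes the outcome exactly when space r + 1 is
  -- the last vacant one: it then fails instead of parking there.
  miss-step : ∀ r F o k → r < length o →
    indicator (F + miss (suc (suc r)) o ≡ᵇ k) + indicator ((F ≡ᵇ k) ∧ lastVacant (suc r) o)
      ≡ indicator (F + miss (suc r) o ≡ᵇ k) + indicator ((suc F ≡ᵇ k) ∧ lastVacant (suc r) o)
  miss-step r F o k r< with drop-∷ r o r<
  ... | c , rest , e with miss-at r o c rest e
  ...   | m₁ , m₂ rewrite m₁ | m₂ | e with c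
  ...     | true rewrite ∧-zeroʳ (F ≡ᵇ k) | ∧-zeroʳ (suc F ≡ᵇ k) = refl
  ...     | false rewrite miss-1≡full rest with and rest
  ...       | true rewrite +-comm F 1 | +-identityʳ F | ∧-identityʳ (F ≡ᵇ k) | ∧-identityʳ (suc F ≡ᵇ k) =
    +-comm (indicator (suc F ≡ᵇ k)) (indicator (F ≡ᵇ k))
  ...       | false rewrite ∧-zeroʳ (F ≡ᵇ k) | ∧-zeroʳ (suc F ≡ᵇ k) = refl

  pr-step : ∀ N t r k → suc (suc r) ≤ suc N ⊓ t →
    pr (suc (suc r)) (suc N) (suc N) t k + ΣLastVacant N (suc N) (suc N ⊓ t) (_≡ᵇ k) (suc r)
      ≡ pr (suc r) (suc N) (suc N) t k + ΣLastVacant N (suc N) (suc N ⊓ t) (λ F → suc F ≡ᵇ k) (suc r)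
  pr-step N t r k r+2≤ = begin
    pr (suc (suc r)) (suc N) (suc N) t k + S
      ≡⟨ cong (_+ S) (pr≡ΣSeq (suc (suc r)) N (suc N) t k (s≤s z≤n) r+2≤) ⟩
    ΣSeq N u (λ b → indicator (misses Z (suc (suc r) ∷ b) ≡ᵇ k)) + S
      ≡⟨ sym (ΣSeq-+ N u _ _) ⟩
    ΣSeq N u (λ b → indicator (misses Z (suc (suc r) ∷ b) ≡ᵇ k) + lastVacantAfter (suc N) (_≡ᵇ k) (suc r) b)
      ≡⟨ ΣSeq-cong N u (λ b _ _ → pointwise b) ⟩
    ΣSeq N u (λ b → indicator (misses Z (suc r ∷ b) ≡ᵇ k) + lastVacantAfter (suc N) (λ F → suc F ≡ᵇ k) (suc r) b)
      ≡⟨ ΣSeq-+ N u _ _ ⟩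
    ΣSeq N u (λ b → indicator (misses Z (suc r ∷ b) ≡ᵇ k)) + S′
      ≡⟨ cong (_+ S′) (sym (pr≡ΣSeq (suc r) N (suc N) t k (s≤s z≤n) (≤-trans (n≤1+n _) r+2≤))) ⟩
    pr (suc r) (suc N) (suc N) t k + S′ ∎
    where
      open ≡-Reasoning
      u = suc N ⊓ t
      Z = empty (suc N)
      S = ΣLastVacant N (suc N) u (_≡ᵇ k) (suc r)
      S′ = ΣLastVacant N (suc N) u (λ F → suc F ≡ᵇ k) (suc r)
      r<length : ∀ b → r < length (occupancy Z b)
      r<length b = ≤-trans (≤-trans (n≤1+n _) (≤-trans r+2≤ (m⊓n≤m (suc N) t)))
                           (≤-reflexive (sym (trans (length-occupancy Z b) (length-replicate (suc N)))))
      pointwise : ∀ b → indicator (misses Z (suc (suc r) ∷ b) ≡ᵇ k) + lastVacantAfter (suc N) (_≡ᵇ k) (suc r) b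
                        ≡ indicator (misses Z (suc r ∷ b) ≡ᵇ k) + lastVacantAfter (suc N) (λ F → suc F ≡ᵇ k) (suc r) b
      pointwise b rewrite misses-rotate (suc (suc r)) Z b | misses-rotate (suc r) Z b =
        miss-step r (misses Z b) (occupancy Z b) k (r<length b)

  vacant-take-suc : ∀ L o → vacant (take (suc L) o) ≡ vacant (take L o) + indicator (not (firstOccupied (drop L o)))
  vacant-take-suc zero [] = refl
  vacant-take-suc zero (true ∷ o) = refl
  vacant-take-suc zero (false ∷ o) = refl
  vacant-take-suc (suc L) [] = refl
  vacant-take-suc (suc L) (true ∷ o) = vacant-take-suc L o
  vacant-take-suc (suc L) (false ∷ o) = cong suc (vacant-take-suc L o)

  vacant-take≤ : ∀ L o → vacant (take L o) ≤ L
  vacant-take≤ zero o = z≤n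
  vacant-take≤ (suc L) [] = z≤n
  vacant-take≤ (suc L) (true ∷ o) = m≤n⇒m≤1+n (vacant-take≤ L o)
  vacant-take≤ (suc L) (false ∷ o) = s≤s (vacant-take≤ L o)

  vacant-take+drop : ∀ m o → vacant (take m o) + vacant (drop m o) ≡ vacant o
  vacant-take+drop zero o = refl
  vacant-take+drop (suc m) [] = refl
  vacant-take+drop (suc m) (true ∷ o) = vacant-take+drop m o
  vacant-take+drop (suc m) (false ∷ o) = cong suc (vacant-take+drop m o)

  -- Space x + 1 is vacant and exactly r spaces before it are vacant.
  isVacantRank : ℕ → List Bool → ℕ → ℕ
  isVacantRank r o x = indicator (not (firstOccupied (drop x o)) ∧ (vacant (take x o) ≡ᵇ r))

  Σ<-isVacantRank : ∀ L r o → Σ< L (isVacantRank r o) ≡ indicator (r <ᵇ vacant (take L o))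
  Σ<-isVacantRank zero r o = refl
  Σ<-isVacantRank (suc L) r o = begin
    Σ< (suc L) (isVacantRank r o)                     ≡⟨ cong (λ z → Σ< z (isVacantRank r o)) (+-comm 1 L) ⟩
    Σ< (L + 1) (isVacantRank r o)                     ≡⟨ Σ<-split L 1 (isVacantRank r o) ⟩
    Σ< L (isVacantRank r o) + (isVacantRank r o (L + 0) + 0)
      ≡⟨ cong₂ _+_ (Σ<-isVacantRank L r o) (trans (+-identityʳ _) (cong (isVacantRank r o) (+-identityʳ L))) ⟩
    indicator (r <ᵇ V) + isVacantRank r o L           ≡⟨ <ᵇ-step (not (firstOccupied (drop L o))) ⟩
    indicator (r <ᵇ (V + indicator (not (firstOccupied (drop L o)))))
      ≡⟨ cong (λ z → indicator (r <ᵇ z)) (sym (vacant-take-suc L o)) ⟩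
    indicator (r <ᵇ vacant (take (suc L) o)) ∎
    where
      open ≡-Reasoning
      V = vacant (take L o)
      <ᵇ-suc : ∀ r X → indicator (r <ᵇ X) + indicator (X ≡ᵇ r) ≡ indicator (r <ᵇ suc X)
      <ᵇ-suc zero zero = refl
      <ᵇ-suc zero (suc X) = refl
      <ᵇ-suc (suc r) zero = refl
      <ᵇ-suc (suc r) (suc X) = <ᵇ-suc r X
      <ᵇ-step : ∀ c → indicator (r <ᵇ V) + indicator (c ∧ (V ≡ᵇ r)) ≡ indicator (r <ᵇ (V + indicator c))
      <ᵇ-step false = trans (+-identityʳ _) (cong (λ z → indicator (r <ᵇ z)) (sym (+-identityʳ V)))
      <ᵇ-step true = trans (<ᵇ-suc r V) (cong (λ z → indicator (r <ᵇ z)) (+-comm 1 V))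

  -- If spaces 1, …, l - 1 contain exactly k vacant ones, the k-th of them is one of k, …, l - 1.
  Σ<-isVacantRank≡1 : ∀ k l o → 1 ≤ k → k ≤ l → vacant (take (l ∸ 1) o) ≡ k →
    Σ< (l ∸ k) (λ j → isVacantRank (k ∸ 1) o (k ∸ 1 + j)) ≡ 1
  Σ<-isVacantRank≡1 (suc k) (suc l) o _ (s≤s k≤l) vacant≡ = begin
    Σ< (l ∸ k) (λ j → isVacantRank k o (k + j))
      ≡⟨ cong (_+ Σ< (l ∸ k) (λ j → isVacantRank k o (k + j))) (sym none-before-k) ⟩
    Σ< k (isVacantRank k o) + Σ< (l ∸ k) (λ j → isVacantRank k o (k + j))
      ≡⟨ sym (Σ<-split k (l ∸ k) (isVacantRank k o)) ⟩
    Σ< (k + (l ∸ k)) (isVacantRank k o)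
      ≡⟨ cong (λ z → Σ< z (isVacantRank k o)) (m+[n∸m]≡n k≤l) ⟩
    Σ< l (isVacantRank k o)
      ≡⟨ Σ<-isVacantRank l k o ⟩
    indicator (k <ᵇ vacant (take l o))
      ≡⟨ cong (λ z → indicator (k <ᵇ z)) vacant≡ ⟩
    indicator (k <ᵇ suc k)
      ≡⟨ cong indicator (<ᵇ-suc k) ⟩
    1 ∎
    where
      open ≡-Reasoning
      <ᵇ-suc : ∀ k → (k <ᵇ suc k) ≡ true
      <ᵇ-suc zero = refl
      <ᵇ-suc (suc k) = <ᵇ-suc k
      not-kth : ∀ x → x < k → isVacantRank k o x ≡ 0
      not-kth x x<k = trans
        (cong (λ c → indicator (not (firstOccupied (drop x o)) ∧ c))
              (≢⇒≡ᵇ≡false _ k (λ e → <-irrefl e (≤-<-trans (vacant-take≤ x o) x<k))))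
        (cong indicator (∧-zeroʳ (not (firstOccupied (drop x o)))))
      none-before-k : Σ< k (isVacantRank k o) ≡ 0
      none-before-k = trans (Σ<-cong k not-kth) (Σ<-0 k)

  fullAfter : ℕ → ℕ → List ℕ → ℕ
  fullAfter m K b = indicator ((misses (empty m) b ≡ᵇ K) ∧ and (occupancy (empty m) b))

  parksIn : ℕ → List ℕ → ℕ
  parksIn i lo = indicator (misses (empty i) lo ≡ᵇ 0)

  byGap-dead : ∀ i j ψ b → gapSurvives (suc i) b (empty i) ≡ false → byGap (suc i) j (parksIn i) ψ b ≡ 0
  byGap-dead i j ψ b dead with hitsGap (suc i) b | misses (empty i) (prefsBelow (suc i) b) ≡ᵇ 0
  ... | true | _ = refl
  ... | false | false = trans (+-identityʳ _) (*-zeroʳ (indicator (length (prefsBelow (suc i) b) ≡ᵇ j)))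

  byGap-alive : ∀ i j ψ b → gapSurvives (suc i) b (empty i) ≡ true →
    byGap (suc i) j (parksIn i) ψ b ≡ indicator (length (prefsBelow (suc i) b) ≡ᵇ j) * ψ (prefsAbove (suc i) b)
  byGap-alive i j ψ b alive with hitsGap (suc i) b | misses (empty i) (prefsBelow (suc i) b) ≡ᵇ 0
  ... | false | true = trans (+-identityʳ _) (cong (indicator (length (prefsBelow (suc i) b) ≡ᵇ j) *_) (+-identityʳ _))

  gapSurvives⇒¬hitsGap : ∀ g b lo → gapSurvives g b lo ≡ true → hitsGap g b ≡ false
  gapSurvives⇒¬hitsGap g b lo survives with hitsGap g b | survives
  ... | false | _ = refl

  gapSurvives⇒split : ∀ i m b → gapSurvives (suc i) b (empty i) ≡ true →
    occupancy (empty i ++ false ∷ empty m) b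
      ≡ occupancy (empty i) (prefsBelow (suc i) b) ++ false ∷ occupancy (empty m) (prefsAbove (suc i) b)
    × misses (empty i ++ false ∷ empty m) b ≡ misses (empty m) (prefsAbove (suc i) b)
    × length (occupancy (empty i) (prefsBelow (suc i) b)) ≡ i
    × occupied (occupancy (empty i) (prefsBelow (suc i) b)) ≡ length (prefsBelow (suc i) b)
  gapSurvives⇒split i m b alive =
    proj₁ split , proj₂ split ,
    trans (length-occupancy (empty i) low) (length-replicate i) ,
    trans (sym (cong (_+ occupied (occupancy (empty i) low)) low-parks)) (misses+occupied-empty i low)
    where
      low = prefsBelow (suc i) b
      low-parks : misses (empty i) low ≡ 0
      low-parks = ≡ᵇ≡true⇒≡ _ 0 (proj₂ (∧≡true {not (hitsGap (suc i) b)} alive))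
      split = park-split-at-gap (suc i) b (empty i) (empty m) (cong suc (sym (length-replicate i)))
                                (gapSurvives⇒¬hitsGap (suc i) b (empty i) alive) low-parks

  gapSurvives≡false⇒occupied : ∀ i m b → gapSurvives (suc i) b (empty i) ≡ false →
    firstOccupied (drop i (occupancy (empty i ++ false ∷ empty m) b)) ≡ true
  gapSurvives≡false⇒occupied i m b dead =
    subst (λ n → firstOccupied (drop n (occupancy (empty i ++ false ∷ empty m) b)) ≡ true) (length-replicate i)
          (gap-occupied (suc i) b (empty i) (empty m) (cong suc (sym (length-replicate i))) dead)

  isVacantRank-gap : ∀ lo hi r → isVacantRank r (lo ++ false ∷ hi) (length lo) ≡ indicator (vacant lo ≡ᵇ r)
  isVacantRank-gap lo hi r rewrite drop-length-++ lo (false ∷ hi) | take-length-++ lo (false ∷ hi) = refl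

  ≡ᵇ-swap : ∀ {T V r j} → T + V ≡ r + j → (V ≡ᵇ r) ≡ (T ≡ᵇ j)
  ≡ᵇ-swap {T} {V} {r} {j} e = ⇔⇒≡ _ _
    (λ V≡r → ≡⇒≡ᵇ≡true (+-cancelʳ-≡ V T j (trans e (trans (cong (_+ j) (sym (≡ᵇ≡true⇒≡ V r V≡r))) (+-comm V j)))))
    (λ T≡j → ≡⇒≡ᵇ≡true (+-cancelˡ-≡ T V r (trans e (trans (cong (r +_) (sym (≡ᵇ≡true⇒≡ T j T≡j))) (+-comm r T)))))

  -- When the gap is the (r + 1)-th vacant space and lies before the last vacant space L, the cars split
  -- into a parking function below the gap and a configuration with last vacant space L - i - 1 above it.
  byGap-isVacantRank : ∀ i m b r K L j → i ≡ r + j → suc i < L →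
    byGap (suc i) j (parksIn i) (lastVacantAfter m (_≡ᵇ K) (L ∸ suc i)) b
      ≡ indicator ((misses (empty i ++ false ∷ empty m) b ≡ᵇ K) ∧ lastVacant L (occupancy (empty i ++ false ∷ empty m) b))
        * isVacantRank r (occupancy (empty i ++ false ∷ empty m) b) i
  byGap-isVacantRank i m b r K L j i≡ i<L with gapSurvives (suc i) b (empty i) in survives
  ... | false = begin
    byGap (suc i) j (parksIn i) ψ b ≡⟨ byGap-dead i j ψ b survives ⟩
    0                               ≡⟨ sym (*-zeroʳ (Last b)) ⟩
    Last b * 0                      ≡⟨ cong (λ c → Last b * indicator (not c ∧ (vacant (take i (occupancy Z b)) ≡ᵇ r)))
                                            (sym (gapSurvives≡false⇒occupied i m b survives)) ⟩
    Last b * isVacantRank r (occupancy Z b) i ∎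
    where
      open ≡-Reasoning
      Z = empty i ++ false ∷ empty m
      ψ = lastVacantAfter m (_≡ᵇ K) (L ∸ suc i)
      Last : List ℕ → ℕ
      Last b = indicator ((misses Z b ≡ᵇ K) ∧ lastVacant L (occupancy Z b))
  ... | true with gapSurvives⇒split i m b survives
  ...   | occ≡ , misses≡ , length-lo≡i , occupied-lo rewrite occ≡ | misses≡ = begin
    byGap (suc i) j (parksIn i) ψ b
      ≡⟨ byGap-alive i j ψ b survives ⟩
    indicator (length low ≡ᵇ j) * ψ high
      ≡⟨ *-comm (indicator (length low ≡ᵇ j)) (ψ high) ⟩
    ψ high * indicator (length low ≡ᵇ j)
      ≡⟨ cong₂ _*_ (cong (λ z → indicator ((misses (empty m) high ≡ᵇ K) ∧ z)) (sym shift))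
                   (cong indicator (sym (≡ᵇ-swap {length low} counted))) ⟩
    indicator ((misses (empty m) high ≡ᵇ K) ∧ lastVacant L (lo ++ false ∷ hi)) * indicator (vacant lo ≡ᵇ r)
      ≡⟨ cong (indicator ((misses (empty m) high ≡ᵇ K) ∧ lastVacant L (lo ++ false ∷ hi)) *_) (sym rank) ⟩
    indicator ((misses (empty m) high ≡ᵇ K) ∧ lastVacant L (lo ++ false ∷ hi)) * isVacantRank r (lo ++ false ∷ hi) i ∎
    where
      open ≡-Reasoning
      low = prefsBelow (suc i) b
      high = prefsAbove (suc i) b
      lo = occupancy (empty i) low
      hi = occupancy (empty m) high
      ψ = lastVacantAfter m (_≡ᵇ K) (L ∸ suc i)
      shift : lastVacant L (lo ++ false ∷ hi) ≡ lastVacant (L ∸ suc i) hi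
      shift = trans (lastVacant-shift lo false hi L (subst (λ n → suc n < L) (sym length-lo≡i) i<L))
                    (cong (λ n → lastVacant (L ∸ suc n) hi) length-lo≡i)
      counted : length low + vacant lo ≡ r + j
      counted = trans (cong (_+ vacant lo) (sym occupied-lo)) (trans (occupied+vacant lo) (trans length-lo≡i i≡))
      rank : isVacantRank r (lo ++ false ∷ hi) i ≡ indicator (vacant lo ≡ᵇ r)
      rank = trans (cong (isVacantRank r (lo ++ false ∷ hi)) (sym length-lo≡i)) (isVacantRank-gap lo hi r)

  indicator-* : ∀ (A B : Bool) → (B ≡ true → A ≡ true) → indicator A * indicator B ≡ indicator B
  indicator-* A true B⇒A rewrite B⇒A refl = refl
  indicator-* true false _ = refl
  indicator-* false false _ = refl

  -- If the cars above the gap fill its m spaces with K misses, K + m cars are above it and j below.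
  full⇒length-prefsBelow : ∀ i m b K j → length b ≡ i + m → j + K ≡ i → hitsGap (suc i) b ≡ false →
    ((misses (empty m) (prefsAbove (suc i) b) ≡ᵇ K) ∧ and (occupancy (empty m) (prefsAbove (suc i) b))) ≡ true →
    length (prefsBelow (suc i) b) ≡ j
  full⇒length-prefsBelow i m b K j length-b j+K≡i no-hit full =
    +-cancelʳ-≡ K _ _ (+-cancelʳ-≡ m _ _ (trans (+-assoc (length low) K m) lengths))
    where
      low = prefsBelow (suc i) b
      high = prefsAbove (suc i) b
      hi = occupancy (empty m) high
      parts = ∧≡true {misses (empty m) high ≡ᵇ K} full
      hi-full : occupied hi ≡ m
      hi-full = trans (full⇒occupied≡length hi (proj₂ parts)) (trans (length-occupancy (empty m) high) (length-replicate m))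
      length-high : length high ≡ K + m
      length-high = trans (sym (misses+occupied-empty m high)) (cong₂ _+_ (≡ᵇ≡true⇒≡ _ K (proj₁ parts)) hi-full)
      lengths : length low + (K + m) ≡ j + K + m
      lengths = trans (cong (length low +_) (sym length-high))
                      (trans (length-prefsBelow+prefsAbove (suc i) b no-hit)
                             (trans length-b (cong (_+ m) (sym j+K≡i))))

  -- When the gap is the last vacant space, the cars above it fill every space there.
  byGap-lastVacant : ∀ i m b K j → length b ≡ i + m → j + K ≡ i →
    byGap (suc i) j (parksIn i) (fullAfter m K) b
      ≡ indicator ((misses (empty i ++ false ∷ empty m) b ≡ᵇ K) ∧ lastVacant (suc i) (occupancy (empty i ++ false ∷ empty m) b))
  byGap-lastVacant i m b K j length-b j+K≡i with gapSurvives (suc i) b (empty i) in survives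
  ... | false = begin
    byGap (suc i) j (parksIn i) ψ b ≡⟨ byGap-dead i j ψ b survives ⟩
    0                                     ≡⟨ cong indicator (sym (∧-zeroʳ (misses Z b ≡ᵇ K))) ⟩
    indicator ((misses Z b ≡ᵇ K) ∧ false) ≡⟨ cong (λ c → indicator ((misses Z b ≡ᵇ K) ∧ c))
                                                  (sym (firstOccupied⇒¬vacantThenFull (drop i (occupancy Z b)) (gapSurvives≡false⇒occupied i m b survives))) ⟩
    indicator ((misses Z b ≡ᵇ K) ∧ lastVacant (suc i) (occupancy Z b)) ∎
    where
      open ≡-Reasoning
      Z = empty i ++ false ∷ empty m
      ψ = fullAfter m K
  ... | true with gapSurvives⇒split i m b survives
  ...   | occ≡ , misses≡ , length-lo≡i , occupied-lo rewrite occ≡ | misses≡ = begin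
    byGap (suc i) j (parksIn i) ψ b
      ≡⟨ byGap-alive i j ψ b survives ⟩
    indicator (length low ≡ᵇ j) * ψ high
      ≡⟨ indicator-* (length low ≡ᵇ j) _ (λ full → ≡⇒≡ᵇ≡true (full⇒length-prefsBelow i m b K j length-b j+K≡i
                                                        (gapSurvives⇒¬hitsGap (suc i) b (empty i) survives) full)) ⟩
    ψ high
      ≡⟨ cong (λ o → indicator ((misses (empty m) high ≡ᵇ K) ∧ vacantThenFull o))
              (sym (trans (cong (λ n → drop n (lo ++ false ∷ hi)) (sym length-lo≡i)) (drop-length-++ lo (false ∷ hi)))) ⟩
    indicator ((misses (empty m) high ≡ᵇ K) ∧ lastVacant (suc i) (lo ++ false ∷ hi)) ∎
    where
      open ≡-Reasoning
      low = prefsBelow (suc i) b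
      high = prefsAbove (suc i) b
      lo = occupancy (empty i) low
      hi = occupancy (empty m) high
      ψ = fullAfter m K

  ΣFull : ℕ → ℕ → ℕ → ℕ → ℕ
  ΣFull N m t K = ΣSeq N t (fullAfter m K)

  -- With k misses among n cars on n + 1 spaces, k + 1 spaces stay vacant, k of them before the last one.
  vacant-before-lastVacant : ∀ n k l b → length b ≡ n → misses (empty (suc n)) b ≡ k →
    lastVacant l (occupancy (empty (suc n)) b) ≡ true → vacant (take (l ∸ 1) (occupancy (empty (suc n)) b)) ≡ k
  vacant-before-lastVacant n k l b length-b misses≡k last =
    +-cancelʳ-≡ 1 _ _ (begin
      vacant (take (l ∸ 1) O) + 1               ≡⟨ cong (vacant (take (l ∸ 1) O) +_) (sym (vacantThenFull⇒vacant≡1 (drop (l ∸ 1) O) last)) ⟩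
      vacant (take (l ∸ 1) O) + vacant (drop (l ∸ 1) O) ≡⟨ vacant-take+drop (l ∸ 1) O ⟩
      vacant O                                  ≡⟨ +-cancelˡ-≡ (occupied O) _ _ total ⟩
      k + 1                                     ∎)
    where
      open ≡-Reasoning
      O = occupancy (empty (suc n)) b
      total : occupied O + vacant O ≡ occupied O + (k + 1)
      total = begin
        occupied O + vacant O     ≡⟨ occupied+vacant O ⟩
        length O                  ≡⟨ trans (length-occupancy (empty (suc n)) b) (length-replicate (suc n)) ⟩
        suc n                     ≡⟨ cong suc (sym (trans (misses+occupied-empty (suc n) b) length-b)) ⟩
        suc (misses (empty (suc n)) b + occupied O) ≡⟨ cong (λ x → suc (x + occupied O)) misses≡k ⟩
        suc (k + occupied O)      ≡⟨ cong suc (+-comm k (occupied O)) ⟩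
        suc (occupied O + k)      ≡⟨ sym (+-suc (occupied O) k) ⟩
        occupied O + suc k        ≡⟨ cong (occupied O +_) (+-comm 1 k) ⟩
        occupied O + (k + 1)      ∎

  empty-split-≤ : ∀ {i n} → i ≤ n → empty (suc n) ≡ empty i ++ false ∷ empty (n ∸ i)
  empty-split-≤ {i} {n} i≤n =
    trans (cong empty (sym (trans (+-suc i (n ∸ i)) (cong suc (m+[n∸m]≡n i≤n))))) (empty-split i (n ∸ i))

  r+j+1<l : ∀ r l j → r < l → j < l ∸ suc r → suc (r + j) < l
  r+j+1<l r l j r<l j< = ≤-trans (+-monoʳ-< (suc r) j<) (≤-reflexive (m+[n∸m]≡n r<l))

  -- Exactly one j places the k-th vacant space, k = r + 1, at space r + j + 1.
  lastVacantAfter≡Σ<-byGap : ∀ n r l b → r < l → l ≤ n → length b ≡ n →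
    lastVacantAfter (suc n) (_≡ᵇ suc r) l b
      ≡ Σ< (l ∸ suc r) (λ j → byGap (suc (r + j)) j (parksIn (r + j))
                                    (lastVacantAfter (n ∸ (r + j)) (_≡ᵇ suc r) (l ∸ suc (r + j))) b)
  lastVacantAfter≡Σ<-byGap n r l b r<l l≤n length-b = sym (begin
    Σ< (l ∸ suc r) (λ j → byGap (suc (r + j)) j (parksIn (r + j)) (ψ j) b)
      ≡⟨ Σ<-cong (l ∸ suc r) (λ j j< →
           trans (byGap-isVacantRank (r + j) (n ∸ (r + j)) b r (suc r) l j refl (r+j+1<l r l j r<l j<))
                 (cong (λ Z′ → indicator ((misses Z′ b ≡ᵇ suc r) ∧ lastVacant l (occupancy Z′ b))
                               * isVacantRank r (occupancy Z′ b) (r + j))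
                       (sym (empty-split-≤ (≤-trans (<⇒≤ (≤-trans (n≤1+n _) (r+j+1<l r l j r<l j<))) l≤n))))) ⟩
    Σ< (l ∸ suc r) (λ j → Last * isVacantRank r (occupancy Z b) (r + j))
      ≡⟨ Σ<-* (l ∸ suc r) Last _ ⟩
    Last * Σ< (l ∸ suc r) (λ j → isVacantRank r (occupancy Z b) (r + j))
      ≡⟨ one-rank ⟩
    Last ∎)
    where
      open ≡-Reasoning
      Z = empty (suc n)
      Last = lastVacantAfter (suc n) (_≡ᵇ suc r) l b
      ψ : ℕ → List ℕ → ℕ
      ψ j = lastVacantAfter (n ∸ (r + j)) (_≡ᵇ suc r) (l ∸ suc (r + j))
      one-rank : Last * Σ< (l ∸ suc r) (λ j → isVacantRank r (occupancy Z b) (r + j)) ≡ Last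
      one-rank with (misses Z b ≡ᵇ suc r) ∧ lastVacant l (occupancy Z b) in last
      ... | false = refl
      ... | true = trans (+-identityʳ _)
                         (Σ<-isVacantRank≡1 (suc r) l (occupancy Z b) (s≤s z≤n) r<l
                           (vacant-before-lastVacant n (suc r) l b length-b
                             (≡ᵇ≡true⇒≡ _ _ (proj₁ (∧≡true last))) (proj₂ (∧≡true last))))

  gapTerm : ℕ → ℕ → ℕ → ℕ → ℕ → ℕ
  gapTerm n s r l j = (n C j) * ΣSeq j (r + j) (parksIn (r + j))
                      * ΣLastVacant (n ∸ j) (n ∸ (r + j)) (s ∸ suc (r + j)) (_≡ᵇ suc r) (l ∸ suc (r + j))

  -- Splitting at the k-th vacant space, k = r + 1, which lies somewhere in k, …, l - 1.
  ΣLastVacant-byVacantRank : ∀ n s r l → r < l → l < s → s ≤ suc n →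
    ΣLastVacant n (suc n) s (_≡ᵇ suc r) l ≡ Σ< (l ∸ suc r) (gapTerm n s r l)
  ΣLastVacant-byVacantRank n s r l r<l l<s s≤1+n = begin
    ΣSeq n s (lastVacantAfter (suc n) (_≡ᵇ suc r) l)
      ≡⟨ ΣSeq-cong n s (λ b length-b _ → lastVacantAfter≡Σ<-byGap n r l b r<l l≤n length-b) ⟩
    ΣSeq n s (λ b → Σ< (l ∸ suc r) (λ j → byGap (suc (r + j)) j (parksIn (r + j)) (ψ j) b))
      ≡⟨ ΣSeq-Σ< n s (l ∸ suc r) (λ j → byGap (suc (r + j)) j (parksIn (r + j)) (ψ j)) ⟩
    Σ< (l ∸ suc r) (λ j → ΣSeq n s (byGap (suc (r + j)) j (parksIn (r + j)) (ψ j)))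
      ≡⟨ Σ<-cong (l ∸ suc r) (λ j j< →
           trans (cong (λ t → ΣSeq n t (byGap (suc (r + j)) j (parksIn (r + j)) (ψ j))) (s≡ j j<))
                 (ΣSeq-byGap n (r + j) (s ∸ suc (r + j)) j (n ∸ j) (parksIn (r + j)) (ψ j) (m+[n∸m]≡n (j≤n j j<)))) ⟩
    Σ< (l ∸ suc r) (gapTerm n s r l) ∎
    where
      open ≡-Reasoning
      ψ : ℕ → List ℕ → ℕ
      ψ j = lastVacantAfter (n ∸ (r + j)) (_≡ᵇ suc r) (l ∸ suc (r + j))
      l≤n : l ≤ n
      l≤n = ≤-pred (≤-trans l<s s≤1+n)
      j≤n : ∀ j → j < l ∸ suc r → j ≤ n
      j≤n j j< = ≤-trans (<⇒≤ j<) (≤-trans (m∸n≤m l (suc r)) l≤n)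
      s≡ : ∀ j → j < l ∸ suc r → s ≡ r + j + suc (s ∸ suc (r + j))
      s≡ j j< = sym (trans (+-suc (r + j) _) (m+[n∸m]≡n (≤-trans (<⇒≤ (r+j+1<l r l j r<l j<)) (<⇒≤ l<s))))

  ΣLastVacant-atGap : ∀ n s r l → r ≤ l → suc l < s → s ≤ suc n →
    ΣLastVacant n (suc n) s (_≡ᵇ r) (suc l)
      ≡ (n C (l ∸ r)) * ΣSeq (l ∸ r) l (parksIn l) * ΣFull (n ∸ (l ∸ r)) (n ∸ l) (s ∸ suc l) r
  ΣLastVacant-atGap n s r l r≤l l<s s≤1+n = begin
    ΣSeq n s (lastVacantAfter (suc n) (_≡ᵇ r) (suc l))
      ≡⟨ ΣSeq-cong n s (λ b length-b _ → sym (trans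
           (byGap-lastVacant l (n ∸ l) b r (l ∸ r) (trans length-b (sym (m+[n∸m]≡n l≤n))) (m∸n+n≡m r≤l))
           (cong (λ Z′ → indicator ((misses Z′ b ≡ᵇ r) ∧ lastVacant (suc l) (occupancy Z′ b))) (sym (empty-split-≤ l≤n))))) ⟩
    ΣSeq n s (byGap (suc l) (l ∸ r) (parksIn l) ψ)
      ≡⟨ cong (λ t → ΣSeq n t (byGap (suc l) (l ∸ r) (parksIn l) ψ)) s≡ ⟩
    ΣSeq n (l + suc (s ∸ suc l)) (byGap (suc l) (l ∸ r) (parksIn l) ψ)
      ≡⟨ ΣSeq-byGap n l (s ∸ suc l) (l ∸ r) (n ∸ (l ∸ r)) (parksIn l) ψ (m+[n∸m]≡n (≤-trans (m∸n≤m l r) l≤n)) ⟩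
    (n C (l ∸ r)) * ΣSeq (l ∸ r) l (parksIn l) * ΣSeq (n ∸ (l ∸ r)) (s ∸ suc l) ψ ∎
    where
      open ≡-Reasoning
      ψ = fullAfter (n ∸ l) r
      l≤n : l ≤ n
      l≤n = ≤-pred (≤-trans (<⇒≤ l<s) s≤1+n)
      s≡ : s ≡ l + suc (s ∸ suc l)
      s≡ = sym (trans (+-suc l _) (m+[n∸m]≡n (<⇒≤ l<s)))

  miss-snoc-occupied : ∀ t o → t ≤ length o → miss t (o ++ [ true ]) ≡ miss t o
  miss-snoc-occupied t o t≤ with miss≡0⊎miss≡1 t o
  ... | inj₁ m0 = trans (proj₂ (park-++-inside t o [ true ] m0)) (sym m0)
  ... | inj₂ m1 = trans (proj₂ (park-++-overflow t o [ true ] (m≤n⇒m≤1+n t≤) m1)) (sym m1)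

  miss-snoc-vacant : ∀ t o → t ≤ length o → miss t (o ++ [ false ]) ≡ 0
  miss-snoc-vacant t o t≤ with miss≡0⊎miss≡1 t o
  ... | inj₁ m0 = proj₂ (park-++-inside t o [ false ] m0)
  ... | inj₂ m1 = proj₂ (park-++-overflow t o [ false ] (m≤n⇒m≤1+n t≤) m1)

  -- F and o are the misses and final occupancy of the other cars on all but the last space,
  -- which is vacant; o is full exactly when F = 0, and a car preferring t fails on o once F ≥ 1.
  first-or-last : ∀ F o t → and o ≡ (F ≡ᵇ 0) → (1 ≤ F → miss t o ≡ 1) → t ≤ length o →
    indicator (F ∸ 1 + miss 1 (o ++ [ not (F ≡ᵇ 0) ]) ≡ᵇ 0)
      ≡ indicator (F ∸ 1 + miss t (o ++ [ not (F ≡ᵇ 0) ]) ≡ᵇ 1) + indicator (F ≡ᵇ 0)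
  first-or-last zero o t full _ t≤
    rewrite miss-1≡full (o ++ [ false ]) | and-snoc o false | ∧-zeroʳ (and o) | miss-snoc-vacant t o t≤ = refl
  first-or-last (suc zero) o t full fails t≤
    rewrite miss-1≡full (o ++ [ true ]) | and-snoc o true | ∧-identityʳ (and o) | full
          | miss-snoc-occupied t o t≤ | fails (s≤s z≤n) = refl
  first-or-last (suc (suc F)) o t _ fails t≤ rewrite miss-snoc-occupied t o t≤ | fails (s≤s z≤n) | +-comm F 1 = refl

  full≡no-misses : ∀ N b → length b ≡ N → and (occupancy (empty N) b) ≡ (misses (empty N) b ≡ᵇ 0)
  full≡no-misses N b length-b = ⇔⇒≡ _ _
    (λ full → ≡⇒≡ᵇ≡true (+-cancelʳ-≡ (occupied O) F 0
       (trans F+occupied (trans (sym length-O) (sym (full⇒occupied≡length O full))))))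
    (λ F≡0 → occupied≡length⇒full O
       (trans (sym (cong (_+ occupied O) (≡ᵇ≡true⇒≡ F 0 F≡0))) (trans F+occupied (sym length-O))))
    where
      F = misses (empty N) b
      O = occupancy (empty N) b
      length-O : length O ≡ N
      length-O = trans (length-occupancy (empty N) b) (length-replicate N)
      F+occupied : F + occupied O ≡ N
      F+occupied = trans (misses+occupied-empty N b) length-b

  -- Both sides say that the cars park on spaces 1, …, m with k of them left over.
  full-with-misses≡padded-parks : ∀ m k t b → length b ≡ m + k → All (_≤ t) b → t ≤ m →
    ((misses (empty m) b ≡ᵇ k) ∧ and (occupancy (empty m) b)) ≡ (misses (empty (m + k)) b ≡ᵇ 0)
  full-with-misses≡padded-parks m k t b length-b b≤t t≤m = ⇔⇒≡ _ _
    (λ e → ≡⇒≡ᵇ≡true (trans F≡Fm∸k (trans (cong (_∸ k) (≡ᵇ≡true⇒≡ _ _ (proj₁ (∧≡true e)))) (n∸n≡0 k))))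
    (λ F≡0 → let Fm≡k = ≤-antisym (m∸n≡0⇒m≤n (trans (sym F≡Fm∸k) (≡ᵇ≡true⇒≡ F 0 F≡0))) k≤Fm in
       cong₂ _∧_ (≡⇒≡ᵇ≡true Fm≡k)
                 (occupied≡length⇒full Om (trans (+-cancelˡ-≡ k _ _
                   (trans (cong (_+ occupied Om) (sym Fm≡k)) (trans Fm+occupied (+-comm m k)))) (sym length-Om))))
    where
      F = misses (empty (m + k)) b
      Fm = misses (empty m) b
      Om = occupancy (empty m) b
      F≡Fm∸k : F ≡ Fm ∸ k
      F≡Fm∸k = trans (cong (λ z → misses z b) (empty-+ m k))
                     (misses-pad (empty m) k b (All≤-mono (≤-trans t≤m (≤-reflexive (sym (length-replicate m)))) b b≤t))
      Fm+occupied : Fm + occupied Om ≡ m + k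
      Fm+occupied = trans (misses+occupied-empty m b) length-b
      length-Om : length Om ≡ m
      length-Om = trans (length-occupancy (empty m) b) (length-replicate m)
      k≤Fm : k ≤ Fm
      k≤Fm = +-cancelʳ-≤ m k Fm (≤-trans (≤-reflexive (trans (+-comm k m) (sym Fm+occupied)))
                                         (+-monoʳ-≤ Fm (≤-trans (occupied≤length Om) (≤-reflexive length-Om))))

  -- With the first car preferring 1 all cars park exactly when the others leave a single space v
  -- vacant; with preference t that car then fails if v < t, and otherwise v = N + 1, as no car
  -- prefers a space beyond t.
  parks-first≡ : ∀ N t b → length b ≡ N → All (_≤ t) b → t ≤ N →
    indicator (misses (empty (suc N)) (1 ∷ b) ≡ᵇ 0)
      ≡ indicator (misses (empty (suc N)) (t ∷ b) ≡ᵇ 1) + indicator (misses (empty N) b ≡ᵇ 0)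
  parks-first≡ N t b length-b b≤t t≤N = begin
    indicator (misses Z (1 ∷ b) ≡ᵇ 0)
      ≡⟨ cong (λ z → indicator (z ≡ᵇ 0)) (misses-rotate 1 Z b) ⟩
    indicator (misses Z b + miss 1 (occupancy Z b) ≡ᵇ 0)
      ≡⟨ cong₂ (λ x o → indicator (x + miss 1 o ≡ᵇ 0)) (proj₁ snoc) (proj₂ snoc) ⟩
    indicator (F ∸ 1 + miss 1 (O ++ [ not (F ≡ᵇ 0) ]) ≡ᵇ 0)
      ≡⟨ first-or-last F O t (full≡no-misses N b length-b) (misses≥1⇒miss t (empty N) b b≤t) t≤O ⟩
    indicator (F ∸ 1 + miss t (O ++ [ not (F ≡ᵇ 0) ]) ≡ᵇ 1) + indicator (F ≡ᵇ 0)
      ≡⟨ cong₂ (λ x o → indicator (x + miss t o ≡ᵇ 1) + indicator (F ≡ᵇ 0)) (sym (proj₁ snoc)) (sym (proj₂ snoc)) ⟩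
    indicator (misses Z b + miss t (occupancy Z b) ≡ᵇ 1) + indicator (F ≡ᵇ 0)
      ≡⟨ cong (λ x → indicator (x ≡ᵇ 1) + indicator (F ≡ᵇ 0)) (sym (misses-rotate t Z b)) ⟩
    indicator (misses Z (t ∷ b) ≡ᵇ 1) + indicator (F ≡ᵇ 0) ∎
    where
      open ≡-Reasoning
      Z = empty (suc N)
      F = misses (empty N) b
      O = occupancy (empty N) b
      t≤O : t ≤ length O
      t≤O = ≤-trans t≤N (≤-reflexive (sym (trans (length-occupancy (empty N) b) (length-replicate N))))
      b≤N : All (_≤ length (empty N)) b
      b≤N = All≤-mono (≤-trans t≤N (≤-reflexive (sym (length-replicate N)))) b b≤t
      snoc : misses Z b ≡ F ∸ 1 × occupancy Z b ≡ O ++ [ not (F ≡ᵇ 0) ]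
      snoc = subst (λ Z′ → misses Z′ b ≡ F ∸ 1 × occupancy Z′ b ≡ O ++ [ not (F ≡ᵇ 0) ])
                   (sym (replicate-snoc N false)) (misses-snoc-vacant (empty N) b b≤N)

  pr-1≡pr-t+ΣFull : ∀ m k t → 1 ≤ t → t ≤ m →
    pr 1 (suc (m + k)) (suc (m + k)) t 0 ≡ pr t (suc (m + k)) (suc (m + k)) t 1 + ΣFull (m + k) m t k
  pr-1≡pr-t+ΣFull m k t 1≤t t≤m = begin
    pr 1 (suc N) (suc N) t 0
      ≡⟨ pr≡ΣSeq 1 N (suc N) t 0 ≤-refl (≤-trans 1≤t (≤-reflexive (sym ⊓≡t))) ⟩
    ΣSeq N (suc N ⊓ t) (λ b → indicator (misses Z (1 ∷ b) ≡ᵇ 0))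
      ≡⟨ cong (λ u → ΣSeq N u (λ b → indicator (misses Z (1 ∷ b) ≡ᵇ 0))) ⊓≡t ⟩
    ΣSeq N t (λ b → indicator (misses Z (1 ∷ b) ≡ᵇ 0))
      ≡⟨ ΣSeq-cong N t (λ b length-b b≤t →
           trans (parks-first≡ N t b length-b b≤t t≤N)
                 (cong (indicator (misses Z (t ∷ b) ≡ᵇ 1) +_)
                       (cong indicator (sym (full-with-misses≡padded-parks m k t b length-b b≤t t≤m))))) ⟩
    ΣSeq N t (λ b → indicator (misses Z (t ∷ b) ≡ᵇ 1) + fullAfter m k b)
      ≡⟨ ΣSeq-+ N t _ _ ⟩
    ΣSeq N t (λ b → indicator (misses Z (t ∷ b) ≡ᵇ 1)) + ΣFull N m t k
      ≡⟨ cong (λ u → ΣSeq N u (λ b → indicator (misses Z (t ∷ b) ≡ᵇ 1)) + ΣFull N m t k) (sym ⊓≡t) ⟩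
    ΣSeq N (suc N ⊓ t) (λ b → indicator (misses Z (t ∷ b) ≡ᵇ 1)) + ΣFull N m t k
      ≡⟨ cong (_+ ΣFull N m t k) (sym (pr≡ΣSeq t N (suc N) t 1 1≤t (≤-reflexive (sym ⊓≡t)))) ⟩
    pr t (suc N) (suc N) t 1 + ΣFull N m t k ∎
    where
      open ≡-Reasoning
      N = m + k
      Z = empty (suc N)
      t≤N : t ≤ N
      t≤N = ≤-trans t≤m (m≤m+n m k)
      ⊓≡t : suc N ⊓ t ≡ t
      ⊓≡t = m≥n⇒m⊓n≡n (≤-trans t≤N (n≤1+n N))


module Identity where

  open Parking
  open import Defs
  open import Data.Nat
  open import Data.Nat.Properties
  open import Data.Nat.Combinatorics using (_C_)
  open import Data.Nat.Tactic.RingSolver using (solve-∀)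
  open import Data.Bool using (_∧_)
  open import Data.List using (_++_; map; upTo; applyUpTo)
  open import Data.List.Properties using (length-replicate)
  open import Data.Product using (_,_)
  open import Data.Integer using (ℤ; +_; -_; _-_; _⊖_) renaming (_+_ to _+ℤ_; _*_ to _*ℤ_)
  import Data.Integer.Properties as ℤ
  open import Function using (_∘_)
  open import Relation.Binary.PropositionalEquality

  +a-+b≡+d-+c : ∀ a b c d → a + c ≡ b + d → + a - + b ≡ + d - + c
  +a-+b≡+d-+c a b c d a+c≡b+d = begin
    + a - + b                   ≡⟨ ℤ.m-n≡m⊖n a b ⟩
    a ⊖ b                       ≡⟨ sym (ℤ.+-cancelˡ-⊖ c a b) ⟩
    (c + a) ⊖ (c + b)           ≡⟨ cong₂ _⊖_ (trans (+-comm c a) a+c≡b+d) (+-comm c b) ⟩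
    (b + d) ⊖ (b + c)           ≡⟨ ℤ.+-cancelˡ-⊖ b d c ⟩
    d ⊖ c                       ≡⟨ sym (ℤ.m-n≡m⊖n d c) ⟩
    + d - + c                   ∎
    where open ≡-Reasoning

  +a*+b*-+c : ∀ a b c → + a *ℤ + b *ℤ - + c ≡ - + (a * b * c)
  +a*+b*-+c a b c = begin
    + a *ℤ + b *ℤ - + c   ≡⟨ sym (ℤ.neg-distribʳ-* (+ a *ℤ + b) (+ c)) ⟩
    - (+ a *ℤ + b *ℤ + c) ≡⟨ cong (λ z → - (z *ℤ + c)) (sym (ℤ.pos-* a b)) ⟩
    - (+ (a * b) *ℤ + c)  ≡⟨ cong -_ (sym (ℤ.pos-* (a * b) c)) ⟩
    - + (a * b * c)       ∎
    where open ≡-Reasoning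

  sumℤ-map-applyUpTo-neg : ∀ m (g : ℕ → ℕ) (f : ℕ → ℤ) (V : ℕ → ℕ) → (∀ j → j < m → f (g j) ≡ - + V j) →
    sumℤ (map f (applyUpTo g m)) ≡ - + Σ< m V
  sumℤ-map-applyUpTo-neg zero g f V _ = refl
  sumℤ-map-applyUpTo-neg (suc m) g f V f≡ = begin
    f (g 0) +ℤ sumℤ (map f (applyUpTo (g ∘ suc) m))
      ≡⟨ cong₂ _+ℤ_ (f≡ 0 (s≤s z≤n)) (sumℤ-map-applyUpTo-neg m (g ∘ suc) f (V ∘ suc) (λ j j< → f≡ (suc j) (s≤s j<))) ⟩
    - + V 0 +ℤ - + Σ< m (V ∘ suc)      ≡⟨ sym (ℤ.neg-distrib-+ (+ V 0) _) ⟩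
    - (+ V 0 +ℤ + Σ< m (V ∘ suc))      ≡⟨ cong -_ (sym (ℤ.pos-+ (V 0) _)) ⟩
    - + (V 0 + Σ< m (V ∘ suc))         ∎
    where open ≡-Reasoning

  p≡ΣSeq-parksIn : ∀ j i → p j i i 0 ≡ ΣSeq j i (parksIn i)
  p≡ΣSeq-parksIn j i = trans (p≡ΣSeq j i i 0) (cong (λ t → ΣSeq j t (parksIn i)) (⊓-idem i))

  pr-difference : ∀ N u r k → suc (suc r) ≤ suc N ⊓ u →
    + pr (suc (suc r)) (suc N) (suc N) u k - + pr (suc r) (suc N) (suc N) u k
      ≡ + ΣLastVacant N (suc N) (suc N ⊓ u) (λ F → suc F ≡ᵇ k) (suc r) - + ΣLastVacant N (suc N) (suc N ⊓ u) (_≡ᵇ k) (suc r)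
  pr-difference N u r k r+2≤ =
    +a-+b≡+d-+c (pr (suc (suc r)) (suc N) (suc N) u k) (pr (suc r) (suc N) (suc N) u k)
                (ΣLastVacant N (suc N) (suc N ⊓ u) (_≡ᵇ k) (suc r)) _ (pr-step N u r k r+2≤)

  pr-difference-0 : ∀ N u r → suc (suc r) ≤ suc N ⊓ u →
    + pr (suc (suc r)) (suc N) (suc N) u 0 - + pr (suc r) (suc N) (suc N) u 0
      ≡ - + ΣLastVacant N (suc N) (suc N ⊓ u) (_≡ᵇ 0) (suc r)
  pr-difference-0 N u r r+2≤ =
    trans (pr-difference N u r 0 r+2≤)
          (trans (cong (λ x → + x - + ΣLastVacant N (suc N) (suc N ⊓ u) (_≡ᵇ 0) (suc r)) (ΣSeq-0 N (suc N ⊓ u)))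
                 (ℤ.+-identityˡ _))

  ΣLastVacant-pad : ∀ N m u e L → suc N ≡ m + e → u ≤ m → 1 ≤ L → L ≤ m →
    ΣLastVacant N (suc N) u (_≡ᵇ 0) L ≡ ΣLastVacant N m u (_≡ᵇ e) L
  ΣLastVacant-pad N m u e L N+1≡ u≤m 1≤L L≤m = ΣSeq-cong N u (λ b _ b≤u → cong indicator (begin
    (misses (empty (suc N)) b ≡ᵇ 0) ∧ lastVacant L (occupancy (empty (suc N)) b)
      ≡⟨ cong (λ Z → (misses Z b ≡ᵇ 0) ∧ lastVacant L (occupancy Z b)) (trans (cong empty N+1≡) (empty-+ m e)) ⟩
    (misses (empty m ++ empty e) b ≡ᵇ 0) ∧ lastVacant L (occupancy (empty m ++ empty e) b)
      ≡⟨ misses-lastVacant-pad e 0 (empty m) b L (All≤-mono (≤-trans u≤m (≤-reflexive (sym (length-replicate m)))) b b≤u)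
                               1≤L (≤-trans L≤m (≤-reflexive (sym (length-replicate m)))) ⟩
    (misses (empty m) b ≡ᵇ e + 0) ∧ lastVacant L (occupancy (empty m) b)
      ≡⟨ cong (λ x → (misses (empty m) b ≡ᵇ x) ∧ lastVacant L (occupancy (empty m) b)) (+-identityʳ e) ⟩
    (misses (empty m) b ≡ᵇ e) ∧ lastVacant L (occupancy (empty m) b) ∎))
    where open ≡-Reasoning

  cong₃ : ∀ {A B C D : Set} (f : A → B → C → D) {a a′ b b′ c c′} →
          a ≡ a′ → b ≡ b′ → c ≡ c′ → f a b c ≡ f a′ b′ c′
  cong₃ f refl refl refl = refl

  cong₄ : ∀ {A B C D E : Set} (f : A → B → C → D → E) {a a′ b b′ c c′ d d′} →
          a ≡ a′ → b ≡ b′ → c ≡ c′ → d ≡ d′ → f a b c d ≡ f a′ b′ c′ d′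
  cong₄ f refl refl refl refl = refl

  ∸-via : ∀ x y z → x ≡ z + y → x ∸ y ≡ z
  ∸-via x y z x≡z+y = trans (cong (_∸ y) x≡z+y) (m+n∸n≡m z y)

  -- The j-th summand, with k = k₀ + 1, l = k₀ + j + d₁ + 2, s = l + d₂ + 1 and n = s + d₃.
  module SumTerm (k₀ d₁ d₂ d₃ j : ℕ) where
    r = k₀ + (suc j + d₁)
    s = suc (suc r) + d₂
    n′ = suc r + d₂ + d₃
    i = k₀ + j
    X = suc (k₀ + suc d₁) + d₂ + d₃
    T = suc (suc d₁) + d₂
    m = suc (suc d₁) + d₂ + d₃
    M = suc n′ + suc k₀ ∸ (i + 1)

    W : ℕ
    W = ΣLastVacant (n′ ∸ j) (n′ ∸ i) (s ∸ suc i) (_≡ᵇ suc k₀) (suc r ∸ suc i)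

    T≤m : T ≤ m
    T≤m = m≤m+n T d₃

    X+1≡m+k : suc X ≡ m + suc k₀
    X+1≡m+k = solve k₀ d₁ d₂ d₃
      where solve : ∀ k₀ d₁ d₂ d₃ → suc (suc (k₀ + suc d₁) + d₂ + d₃) ≡ suc (suc d₁) + d₂ + d₃ + suc k₀
            solve = solve-∀

    i+1-k≡j : i + 1 ∸ suc k₀ ≡ j
    i+1-k≡j = ∸-via _ _ _ (solve k₀ j)
      where solve : ∀ k₀ j → k₀ + j + 1 ≡ j + suc k₀
            solve = solve-∀

    M≡X+1 : M ≡ suc X
    M≡X+1 = ∸-via _ _ _ (solve k₀ j d₁ d₂ d₃)
      where solve : ∀ k₀ j d₁ d₂ d₃ → suc (suc (k₀ + (suc j + d₁)) + d₂ + d₃) + suc k₀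
                                      ≡ suc (suc (k₀ + suc d₁) + d₂ + d₃) + (k₀ + j + 1)
            solve = solve-∀

    s-i-1≡T : s ∸ suc i ≡ T
    s-i-1≡T = ∸-via _ _ _ (solve k₀ j d₁ d₂)
      where solve : ∀ k₀ j d₁ d₂ → suc (suc (k₀ + (suc j + d₁))) + d₂ ≡ suc (suc d₁) + d₂ + suc (k₀ + j)
            solve = solve-∀

    l-i≡d₁+2 : suc r ∸ i ≡ suc (suc d₁)
    l-i≡d₁+2 = ∸-via _ _ _ (solve k₀ j d₁)
      where solve : ∀ k₀ j d₁ → suc (k₀ + (suc j + d₁)) ≡ suc (suc d₁) + (k₀ + j)
            solve = solve-∀

    l-i-1≡d₁+1 : suc r ∸ suc i ≡ suc d₁
    l-i-1≡d₁+1 = ∸-via _ _ _ (solve k₀ j d₁)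
      where solve : ∀ k₀ j d₁ → suc (k₀ + (suc j + d₁)) ≡ suc d₁ + suc (k₀ + j)
            solve = solve-∀

    n-j≡X : n′ ∸ j ≡ X
    n-j≡X = ∸-via _ _ _ (solve k₀ j d₁ d₂ d₃)
      where solve : ∀ k₀ j d₁ d₂ d₃ → suc (k₀ + (suc j + d₁)) + d₂ + d₃ ≡ suc (k₀ + suc d₁) + d₂ + d₃ + j
            solve = solve-∀

    n-i≡m : n′ ∸ i ≡ m
    n-i≡m = ∸-via _ _ _ (solve k₀ j d₁ d₂ d₃)
      where solve : ∀ k₀ j d₁ d₂ d₃ → suc (k₀ + (suc j + d₁)) + d₂ + d₃ ≡ suc (suc d₁) + d₂ + d₃ + (k₀ + j)
            solve = solve-∀

    W≡ : W ≡ ΣLastVacant X m T (_≡ᵇ suc k₀) (suc d₁)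
    W≡ = cong₄ (λ N m′ t L → ΣLastVacant N m′ t (_≡ᵇ suc k₀) L) n-j≡X n-i≡m s-i-1≡T l-i-1≡d₁+1

    ⊓≡T : suc X ⊓ T ≡ T
    ⊓≡T = m≥n⇒m⊓n≡n (≤-trans T≤m (≤-trans (m≤m+n m (suc k₀)) (≤-reflexive (sym X+1≡m+k))))

    bracket : + pr (suc r ∸ i) M M (s ∸ (i + 1)) 0 - + pr (suc r ∸ (i + 1)) M M (s ∸ (i + 1)) 0 ≡ - + W
    bracket = begin
      + pr (suc r ∸ i) M M (s ∸ (i + 1)) 0 - + pr (suc r ∸ (i + 1)) M M (s ∸ (i + 1)) 0
        ≡⟨ cong₄ (λ a b N t → + pr a N N t 0 - + pr b N N t 0) l-i≡d₁+2 (trans (cong (suc r ∸_) i+1≡) l-i-1≡d₁+1)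
                 M≡X+1 (trans (cong (s ∸_) i+1≡) s-i-1≡T) ⟩
      + pr (suc (suc d₁)) (suc X) (suc X) T 0 - + pr (suc d₁) (suc X) (suc X) T 0
        ≡⟨ pr-difference-0 X T d₁ (≤-trans (m≤m+n (suc (suc d₁)) d₂) (≤-reflexive (sym ⊓≡T))) ⟩
      - + ΣLastVacant X (suc X) (suc X ⊓ T) (_≡ᵇ 0) (suc d₁)
        ≡⟨ cong (λ t → - + ΣLastVacant X (suc X) t (_≡ᵇ 0) (suc d₁)) ⊓≡T ⟩
      - + ΣLastVacant X (suc X) T (_≡ᵇ 0) (suc d₁)
        ≡⟨ cong (λ x → - + x) (ΣLastVacant-pad X m T (suc k₀) (suc d₁) X+1≡m+k T≤m (s≤s z≤n) d₁+1≤m) ⟩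
      - + ΣLastVacant X m T (_≡ᵇ suc k₀) (suc d₁)
        ≡⟨ cong (λ x → - + x) (sym W≡) ⟩
      - + W ∎
      where
        open ≡-Reasoning
        i+1≡ : i + 1 ≡ suc i
        i+1≡ = +-comm i 1
        d₁+1≤m : suc d₁ ≤ m
        d₁+1≤m = ≤-trans (n≤1+n (suc d₁)) (≤-trans (m≤m+n (suc (suc d₁)) d₂) T≤m)

    term : + (n′ C (i + 1 ∸ suc k₀)) *ℤ + p (i + 1 ∸ suc k₀) i i 0
             *ℤ (+ pr (suc r ∸ i) M M (s ∸ (i + 1)) 0 - + pr (suc r ∸ (i + 1)) M M (s ∸ (i + 1)) 0)
           ≡ - + ((n′ C j) * ΣSeq j i (parksIn i) * W)
    term rewrite i+1-k≡j | p≡ΣSeq-parksIn j i | bracket = +a*+b*-+c (n′ C j) (ΣSeq j i (parksIn i)) W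

  summand : ℕ → ℕ → ℕ → ℕ → ℕ → ℤ
  summand n s k l j = let i = k ∸ 1 + j in
    + ((n ∸ 1) C (i + 1 ∸ k)) *ℤ + p (i + 1 ∸ k) i i 0
      *ℤ (+ pr (l ∸ i) (n + k ∸ (i + 1)) (n + k ∸ (i + 1)) (s ∸ (i + 1)) 0
          - + pr (l ∸ (i + 1)) (n + k ∸ (i + 1)) (n + k ∸ (i + 1)) (s ∸ (i + 1)) 0)

  lastSummand : ℕ → ℕ → ℕ → ℕ → ℤ
  lastSummand n s k l =
    + ((n ∸ 1) C (l ∸ k)) *ℤ + p (l ∸ k) (l ∸ 1) (l ∸ 1) 0
      *ℤ (+ pr 1 (n + k ∸ l) (n + k ∸ l) (s ∸ l) 0 - + pr (s ∸ l) (n + k ∸ l) (n + k ∸ l) (s ∸ l) 1)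

  summand≡-gapTerm : ∀ k₀ d₀ d₂ d₃ j → j < d₀ →
    let r = k₀ + d₀ ; s = suc (suc r) + d₂ ; n′ = suc r + d₂ + d₃ in
    summand (suc n′) s (suc k₀) (suc r) j ≡ - + gapTerm n′ s k₀ (suc r) j
  summand≡-gapTerm k₀ d₀ d₂ d₃ j j<d₀ with m≤n⇒∃[o]m+o≡n j<d₀
  ... | d₁ , refl = SumTerm.term k₀ d₁ d₂ d₃ j

  -- The instance k = k₀ + 1, l = k₀ + d₀ + 1, s = l + d₂ + 1, n = s + d₃ of the theorem.
  module Instance (k₀ d₀ d₂ d₃ : ℕ) where
    r = k₀ + d₀
    s = suc (suc r) + d₂
    n′ = suc r + d₂ + d₃

    S₁ S₂ : ℕ
    S₁ = ΣLastVacant n′ (suc n′) s (_≡ᵇ suc k₀) (suc r)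
    S₂ = ΣLastVacant n′ (suc n′) s (_≡ᵇ k₀) (suc r)

    l<s : suc r < s
    l<s = m≤m+n (suc (suc r)) d₂

    s≤n : s ≤ suc n′
    s≤n = m≤m+n s d₃

    ⊓≡s : suc n′ ⊓ s ≡ s
    ⊓≡s = m≥n⇒m⊓n≡n s≤n

    difference : + pr (suc (suc r)) (suc n′) (suc n′) s (suc k₀) - + pr (suc r) (suc n′) (suc n′) s (suc k₀) ≡ + S₂ - + S₁
    difference = trans (pr-difference n′ s r (suc k₀) (≤-trans l<s (≤-reflexive (sym ⊓≡s))))
                       (cong (λ t → + ΣLastVacant n′ (suc n′) t (_≡ᵇ k₀) (suc r) - + ΣLastVacant n′ (suc n′) t (_≡ᵇ suc k₀) (suc r)) ⊓≡s)

    sum-of-summands : sumℤ (map (summand (suc n′) s (suc k₀) (suc r)) (upTo (suc r ∸ suc k₀))) ≡ - + S₁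
    sum-of-summands =
      trans (sumℤ-map-applyUpTo-neg (suc r ∸ suc k₀) (λ j → j) (summand (suc n′) s (suc k₀) (suc r)) (gapTerm n′ s k₀ (suc r))
              (λ j j< → summand≡-gapTerm k₀ d₀ d₂ d₃ j (subst (j <_) (m+n∸m≡n k₀ d₀) j<)))
            (cong (λ x → - + x) (sym (ΣLastVacant-byVacantRank n′ s k₀ (suc r) (s≤s (m≤m+n k₀ d₀)) l<s s≤n)))

    m = suc (d₂ + d₃)
    t = suc d₂

    n+k-l≡m+k+1 : suc n′ + suc k₀ ∸ suc r ≡ suc (m + k₀)
    n+k-l≡m+k+1 = ∸-via _ _ _ (solve k₀ d₀ d₂ d₃)
      where solve : ∀ k₀ d₀ d₂ d₃ → suc (suc (k₀ + d₀) + d₂ + d₃) + suc k₀ ≡ suc (suc (d₂ + d₃) + k₀) + suc (k₀ + d₀)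
            solve = solve-∀

    s-l≡t : s ∸ suc r ≡ t
    s-l≡t = ∸-via _ _ _ (solve k₀ d₀ d₂)
      where solve : ∀ k₀ d₀ d₂ → suc (suc (k₀ + d₀)) + d₂ ≡ suc d₂ + suc (k₀ + d₀)
            solve = solve-∀

    n-l+1≡m : n′ ∸ r ≡ m
    n-l+1≡m = ∸-via _ _ _ (solve k₀ d₀ d₂ d₃)
      where solve : ∀ k₀ d₀ d₂ d₃ → suc (k₀ + d₀) + d₂ + d₃ ≡ suc (d₂ + d₃) + (k₀ + d₀)
            solve = solve-∀

    n-[l-k]≡m+k : n′ ∸ (r ∸ k₀) ≡ m + k₀
    n-[l-k]≡m+k = trans (cong (n′ ∸_) (m+n∸m≡n k₀ d₀)) (∸-via _ _ _ (solve k₀ d₀ d₂ d₃))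
      where solve : ∀ k₀ d₀ d₂ d₃ → suc (k₀ + d₀) + d₂ + d₃ ≡ suc (d₂ + d₃) + k₀ + d₀
            solve = solve-∀

    last-bracket : + pr 1 (suc n′ + suc k₀ ∸ suc r) (suc n′ + suc k₀ ∸ suc r) (s ∸ suc r) 0
                   - + pr (s ∸ suc r) (suc n′ + suc k₀ ∸ suc r) (suc n′ + suc k₀ ∸ suc r) (s ∸ suc r) 1
                   ≡ + ΣFull (n′ ∸ (r ∸ k₀)) (n′ ∸ r) (s ∸ suc r) k₀
    last-bracket = begin
      + pr 1 (suc n′ + suc k₀ ∸ suc r) (suc n′ + suc k₀ ∸ suc r) (s ∸ suc r) 0
        - + pr (s ∸ suc r) (suc n′ + suc k₀ ∸ suc r) (suc n′ + suc k₀ ∸ suc r) (s ∸ suc r) 1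
        ≡⟨ cong₂ (λ N u → + pr 1 N N u 0 - + pr u N N u 1) n+k-l≡m+k+1 s-l≡t ⟩
      + pr 1 (suc (m + k₀)) (suc (m + k₀)) t 0 - + pr t (suc (m + k₀)) (suc (m + k₀)) t 1
        ≡⟨ +a-+b≡+d-+c (pr 1 (suc (m + k₀)) (suc (m + k₀)) t 0) (pr t (suc (m + k₀)) (suc (m + k₀)) t 1) 0 (ΣFull (m + k₀) m t k₀)
                       (trans (+-identityʳ _) (pr-1≡pr-t+ΣFull m k₀ t (s≤s z≤n) (s≤s (m≤m+n d₂ d₃)))) ⟩
      + ΣFull (m + k₀) m t k₀ - + 0
        ≡⟨ ℤ.+-identityʳ _ ⟩
      + ΣFull (m + k₀) m t k₀
        ≡⟨ sym (cong₃ (λ N m′ u → + ΣFull N m′ u k₀) n-[l-k]≡m+k n-l+1≡m s-l≡t) ⟩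
      + ΣFull (n′ ∸ (r ∸ k₀)) (n′ ∸ r) (s ∸ suc r) k₀ ∎
      where open ≡-Reasoning

    last-summand : lastSummand (suc n′) s (suc k₀) (suc r) ≡ + S₂
    last-summand rewrite last-bracket | p≡ΣSeq-parksIn (r ∸ k₀) r
                       | ΣLastVacant-atGap n′ s k₀ r (m≤m+n k₀ d₀) l<s s≤n =
      trans (cong (_*ℤ + ΣFull (n′ ∸ (r ∸ k₀)) (n′ ∸ r) (s ∸ suc r) k₀) (sym (ℤ.pos-* (n′ C (r ∸ k₀)) _)))
            (sym (ℤ.pos-* ((n′ C (r ∸ k₀)) * ΣSeq (r ∸ k₀) r (parksIn r)) _))


open import Defs
open import Data.Nat using (ℕ; zero; suc; _+_; _∸_; _≤_; _<_; s≤s)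
open import Data.Nat.Properties using (m≤n⇒∃[o]m+o≡n)
open import Data.Nat.Combinatorics using (_C_)
open import Data.Integer using (ℤ; +_; -_; _-_; _*_) renaming (_+_ to _+ℤ_)
import Data.Integer.Properties as ℤ
open import Data.List using (map; upTo)
open import Data.Product using (_,_)
open import Relation.Binary.PropositionalEquality using (_≡_; refl; trans; sym; cong₂)
open Identity using (module Instance)

theorem6p6 : (n s k l : ℕ) → 1 ≤ k → k ≤ l → l < s → s ≤ n →
    (+ pr (suc l) n n s k) - (+ pr l n n s k)
      ≡ sumℤ (map (λ j → let i = k ∸ 1 + j in
                   (+ ((n ∸ 1) C (i + 1 ∸ k))) * (+ p (i + 1 ∸ k) i i 0)
                     * ((+ pr (l ∸ i) (n + k ∸ (i + 1)) (n + k ∸ (i + 1)) (s ∸ (i + 1)) 0)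
                        - (+ pr (l ∸ (i + 1)) (n + k ∸ (i + 1)) (n + k ∸ (i + 1)) (s ∸ (i + 1)) 0)))
                 (upTo (l ∸ k)))
        +ℤ (+ ((n ∸ 1) C (l ∸ k))) * (+ p (l ∸ k) (l ∸ 1) (l ∸ 1) 0)
             * ((+ pr 1 (n + k ∸ l) (n + k ∸ l) (s ∸ l) 0)
                - (+ pr (s ∸ l) (n + k ∸ l) (n + k ∸ l) (s ∸ l) 1))
theorem6p6 n s zero l () _ _ _
theorem6p6 n s (suc k₀) zero _ () _ _
theorem6p6 zero s (suc k₀) (suc r) _ _ (s≤s (s≤s _)) ()
theorem6p6 (suc n′) s (suc k₀) (suc r) _ (s≤s k₀≤r) l<s s≤n
  with m≤n⇒∃[o]m+o≡n k₀≤r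
... | d₀ , refl with m≤n⇒∃[o]m+o≡n l<s
...   | d₂ , refl with m≤n⇒∃[o]m+o≡n s≤n
...     | d₃ , refl =
  trans difference (trans (ℤ.+-comm (+ S₂) (- + S₁)) (sym (cong₂ _+ℤ_ sum-of-summands last-summand)))
  where open Instance k₀ d₀ d₂ d₃
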